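{- For integers $n\ge 1$ and $k\ge 1$ let $p_0(n,k)$ denote the number of partitions of $\{1,\dots,n\}$ of genus one having $k$ parts. Then, as formal power series, $$P_0(x,y)=\sum_{n\geq 4}\sum_{k\geq 2} p_0(n,k)\,x^n y^k=\frac{x^4y^2}{\bigl(1-2(1+y)x+x^2(1-y)^2\bigr)^{5/2}}.$$
   Context: For $n\ge 1$ let $\zeta_n\in S_n$ be the cyclic permutation $\zeta_n(i)=i+1$ for $i<n$, $\zeta_n(n)=1$. Permutations are composed right to left ($\alpha\beta(i)=\alpha(\beta(i))$), and $z(\pi)$ denotes the number of cycles of $\pi$ (fixed points included). The genus $g(\alpha)$ of $\alpha\in S_n$ is the non-negative integer defined by $n+1-2g(\alpha)=z(\alpha)+z(\alpha^{ -1}\zeta_n)$. A partition $P$ of $\{1,\dots,n\}$ is identified with the permutation $\alpha_P$ whose cycles are the blocks of $P$, each block written with its elements in increasing order; the genus of $P$ is the genus of $\alpha_P$, and the parts of $P$ are the cycles of $\alpha_P$. -}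

module Defs where

open import Data.Bool using (Bool; true; false; if_then_else_; _∧_)
open import Data.Nat using (ℕ; zero; suc; _+_; _∸_; _⊔_; _≡ᵇ_; _<ᵇ_; _≤ᵇ_)
open import Data.List using (List; []; _∷_; _++_; map; concatMap; filterᵇ; length; upTo; foldr)
open import Data.Bool.ListAction using (and)
open import Data.Maybe using (Maybe; just; nothing)
open import Data.Integer as ℤ using (ℤ; +_)
open import Data.Product using (_×_)
open import Relation.Binary.PropositionalEquality using (_≡_)

-- Permutations of {1,…,n} are encoded 0-indexed as functions ℕ → ℕ
-- acting on {0,…,n-1} (point i here stands for point i+1 of the paper).

firstWhere : (ℕ → Bool) → List ℕ → Maybe ℕ
firstWhere p [] = nothing
firstWhere p (x ∷ xs) = if p x then just x else firstWhere p xs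

fromMaybe : ℕ → Maybe ℕ → ℕ
fromMaybe d (just x) = x
fromMaybe d nothing  = d

ζ : ℕ → ℕ → ℕ
ζ n i = if suc i <ᵇ n then suc i else 0

inv : ℕ → (ℕ → ℕ) → ℕ → ℕ
inv n π j = fromMaybe j (firstWhere (λ i → π i ≡ᵇ j) (upTo n))

iter : (ℕ → ℕ) → ℕ → ℕ → ℕ
iter π zero    i = i
iter π (suc m) i = π (iter π m i)

isCycleMin : ℕ → (ℕ → ℕ) → ℕ → Bool
isCycleMin n π i = and (map (λ m → i ≤ᵇ iter π m i) (upTo n))

-- z(π): number of cycles (fixed points included) = number of cycle minima
z : ℕ → (ℕ → ℕ) → ℕ
z n π = length (filterᵇ (isCycleMin n π) (upTo n))

-- Set partitions of {0,…,n-1} are encoded (bijectively) by restricted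
-- growth strings: a list s of length n with s[0] = 0 and
-- s[i] ≤ 1 + max(s[0..i-1]); s[i] is the label of the block containing i.

nblocks : List ℕ → ℕ
nblocks = foldr (λ c m → suc c ⊔ m) 0

rgs : ℕ → List (List ℕ)
rgs zero    = [] ∷ []
rgs (suc n) = concatMap (λ s → map (λ c → s ++ (c ∷ [])) (upTo (suc (nblocks s)))) (rgs n)

at : List ℕ → ℕ → ℕ
at []       _       = 0
at (x ∷ xs) zero    = x
at (x ∷ xs) (suc i) = at xs i

-- α_P : each block becomes a cycle with elements in increasing order:
-- i ↦ next larger element of its block, the largest ↦ the smallest.
αP : List ℕ → ℕ → ℕ
αP s i with firstWhere (λ j → (i <ᵇ j) ∧ (at s j ≡ᵇ at s i)) (upTo (length s))
... | just j  = j
... | nothing = fromMaybe i (firstWhere (λ j → at s j ≡ᵇ at s i) (upTo (length s)))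

-- genus of α ∈ S_n is one, i.e.  n + 1 - 2·1 = z(α) + z(α⁻¹ ζ_n)
genusOne : ℕ → (ℕ → ℕ) → Bool
genusOne n α = (z n α + z n (λ i → inv n α (ζ n i)) + 2) ≡ᵇ (n + 1)

-- p₀(n,k): number of partitions of {1,…,n} of genus one with k parts
-- (parts = cycles of α_P)
p₀ : ℕ → ℕ → ℕ
p₀ n k = length (filterᵇ (λ s → genusOne n (αP s) ∧ (z n (αP s) ≡ᵇ k)) (rgs n))

-- Bivariate formal power series over ℤ: F n k = coefficient of xⁿ yᵏ.

FPS : Set
FPS = ℕ → ℕ → ℤ

sumTo : ℕ → (ℕ → ℤ) → ℤ
sumTo zero    f = f 0
sumTo (suc n) f = sumTo n f ℤ.+ f (suc n)

0ₛ 1ₛ X Y : FPS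
0ₛ n k = + 0
1ₛ zero zero = + 1
1ₛ _    _    = + 0
X (suc zero) zero = + 1
X _          _    = + 0
Y zero (suc zero) = + 1
Y _    _          = + 0

infixl 6 _⊕_ _⊖_
infixl 7 _⊛_ _·ₛ_

_⊕_ _⊖_ _⊛_ : FPS → FPS → FPS
(f ⊕ g) n k = f n k ℤ.+ g n k
(f ⊖ g) n k = f n k ℤ.- g n k
(f ⊛ g) n k = sumTo n (λ i → sumTo k (λ j → f i j ℤ.* g (n ∸ i) (k ∸ j)))

_·ₛ_ : ℤ → FPS → FPS
(c ·ₛ f) n k = c ℤ.* f n k

D : FPS
D = 1ₛ ⊖ (+ 2) ·ₛ ((1ₛ ⊕ Y) ⊛ X) ⊕ (X ⊛ X) ⊛ ((1ₛ ⊖ Y) ⊛ (1ₛ ⊖ Y))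

-- R = F^(-5/2) for F with constant term 1: the unique series R with
-- constant term 1 and R² · F⁵ = 1.
IsPow-5/2 : FPS → FPS → Set
IsPow-5/2 F R = (R 0 0 ≡ + 1) × (∀ n k → (R ⊛ R ⊛ F ⊛ F ⊛ F ⊛ F ⊛ F) n k ≡ 1ₛ n k)

P₀ : FPS
P₀ n k = if (4 ≤ᵇ n) ∧ (2 ≤ᵇ k) then + p₀ n k else + 0

{-# OPTIONS --safe #-}
module Submission where

-- Build a partition by inserting the points 0, 1, 2, … one at a time.  The faces are the cycles of
-- σ = ζ α⁻¹, and only the outer face, the cycle of 0, matters.  A new singleton lengthens the outer face;
-- joining a block whose minimum lies on the outer face cuts that face after this minimum; joining
-- a block whose minimum lies on another face glues that face to the outer one and raises the genus by one.
-- So genus one partitions are lattice paths with exactly one gluing, where only the numbers of block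
-- minima on the faces count.  Let c = x (1 + c) (1 + y c), q = 1 + c, p = 1 + y c.  The generating function
-- of the paths from height h after the gluing is p qʰ⁺¹; before it, since q is a characteristic root of
-- the recurrence, it is qʰ⁺¹ times a polynomial in h.  Each resonance contributes a factor
-- T = 1 / (1 - x (1 + y + 2 y c)) = D^(-1/2), and the value at the start is x⁴ y² T⁵.

-- The genus is read off Euler's relation: blocks + faces + 2 genus = n + 1. A new block or a cut
-- supplies the extra unit on the left at unchanged genus; a gluing loses a face, so the genus has
-- to rise, and nothing lowers it again. That joining a block is exactly one cut or one gluing rests
-- on a single fact: of the old edges of σ, only the one leaving the minimum of the joined block
-- changes. The recurrences couple infinitely many unknowns, one for each height, but the unknowns
-- on the right all carry a factor x, so the coefficients of xʳ determine those of xʳ⁺¹. Hence it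
-- suffices to verify closed forms. Of the two characteristic roots q and 1 / (x y q), only q is a
-- power series. Before the gluing, the inhomogeneous term is qʰ times a polynomial in h, so the
-- degree in h grows; comparing coefficients means dividing by 1 - θ, where θ = x y q² is the
-- quotient of the roots, and T = q / (1 - θ). On the other hand 1 / T is, up to sign, the
-- derivative at c of the quadratic polynomial that c annihilates, so 1 / T² is its discriminant,
-- which is D.

open import Defs
open import Algebra using (CommutativeRing)
open import Data.List using (List; []; _∷_; _++_; map; mapMaybe; concat; concatMap; filterᵇ; length; upTo; applyUpTo; [_])
open import Data.Nat using (ℕ; zero; suc; _∸_; _⊔_; _≡ᵇ_; _<ᵇ_; _≤ᵇ_; _<_; _≤_; z≤n; s≤s)
import Data.Nat as ℕ
import Data.Nat.Properties as ℕ
open import Data.Product using (∃; _×_; _,_; proj₁; proj₂)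
open import Data.Sum using (_⊎_; inj₁; inj₂)
open import Function using (_∘_; id; Equivalence)
open import Level using (Level)
open import Relation.Binary.PropositionalEquality as ≡ using (_≡_; _≢_)

-- Power series over a commutative ring

module PowerSeries {a ℓ : Level} (R : CommutativeRing a ℓ) where
  open CommutativeRing R
  open import Relation.Binary.Reasoning.Setoid setoid
  open import Algebra.Properties.CommutativeSemigroup +-commutativeSemigroup using (interchange; x∙yz≈y∙xz)

  Series : Set a
  Series = ℕ → Carrier

  infix 4 _≋_
  infixl 6 _+ₚ_
  infixl 7 _*ₚ_

  _≋_ : Series → Series → Set ℓ
  f ≋ g = ∀ n → f n ≈ g n

  -- The product recurses on its first factor, so that the ring laws follow by structural induction;
  -- `*ₚ-∑` recovers the Cauchy sum.
  _+ₚ_ _*ₚ_ : Series → Series → Series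
  (f +ₚ g) n = f n + g n
  (f *ₚ g) zero = f 0 * g 0
  (f *ₚ g) (suc n) = f 0 * g (suc n) + ((f ∘ suc) *ₚ g) n

  -ₚ_ : Series → Series
  (-ₚ f) n = - f n

  const : Carrier → Series
  const u zero = u
  const u (suc n) = 0#

  0ₚ 1ₚ 𝑥 : Series
  0ₚ n = 0#
  1ₚ = const 1#
  𝑥 zero = 0#
  𝑥 (suc n) = const 1# n

  *ₚ-cong-≤ : ∀ {f f′ g g′} n → (∀ i → i ≤ n → f i ≈ f′ i) → (∀ i → i ≤ n → g i ≈ g′ i) → (f *ₚ g) n ≈ (f′ *ₚ g′) n
  *ₚ-cong-≤ zero f≈ g≈ = *-cong (f≈ 0 z≤n) (g≈ 0 z≤n)
  *ₚ-cong-≤ (suc n) f≈ g≈ = +-cong (*-cong (f≈ 0 z≤n) (g≈ (suc n) ℕ.≤-refl))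
    (*ₚ-cong-≤ n (λ i i≤n → f≈ (suc i) (s≤s i≤n)) (λ i i≤n → g≈ i (ℕ.m≤n⇒m≤1+n i≤n)))

  *ₚ-cong : ∀ {f f′ g g′} → f ≋ f′ → g ≋ g′ → f *ₚ g ≋ f′ *ₚ g′
  *ₚ-cong f≋ g≋ n = *ₚ-cong-≤ n (λ i _ → f≋ i) (λ i _ → g≋ i)

  *ₚ-zeroˡ : ∀ f → 0ₚ *ₚ f ≋ 0ₚ
  *ₚ-zeroˡ f zero = zeroˡ _
  *ₚ-zeroˡ f (suc n) = trans (+-cong (zeroˡ _) (*ₚ-zeroˡ f n)) (+-identityˡ 0#)

  const-*ₚ : ∀ u f n → (const u *ₚ f) n ≈ u * f n
  const-*ₚ u f zero = refl
  const-*ₚ u f (suc n) = trans (+-congˡ (*ₚ-zeroˡ f n)) (+-identityʳ _)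

  𝑥-*ₚ-zero : ∀ f → (𝑥 *ₚ f) 0 ≈ 0#
  𝑥-*ₚ-zero f = zeroˡ _

  𝑥-*ₚ-suc : ∀ f n → (𝑥 *ₚ f) (suc n) ≈ f n
  𝑥-*ₚ-suc f n = begin
    0# * f (suc n) + (1ₚ *ₚ f) n ≈⟨ +-cong (zeroˡ _) (const-*ₚ 1# f n) ⟩
    0# + 1# * f n                ≈⟨ +-identityˡ _ ⟩
    1# * f n                     ≈⟨ *-identityˡ _ ⟩
    f n                          ∎

  *ₚ-distribʳ : ∀ h f g → (f +ₚ g) *ₚ h ≋ f *ₚ h +ₚ g *ₚ h
  *ₚ-distribʳ h f g zero = distribʳ _ _ _
  *ₚ-distribʳ h f g (suc n) = trans (+-cong (distribʳ _ _ _) (*ₚ-distribʳ h (f ∘ suc) (g ∘ suc) n)) (interchange _ _ _ _)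

  -- Peels off the second factor instead of the first; commutativity comes from matching the two
  -- recursions.
  *ₚ-comm-suc : ∀ f g n → (f *ₚ g) (suc n) ≈ g 0 * f (suc n) + (f *ₚ (g ∘ suc)) n
  *ₚ-comm-suc f g zero = trans (+-comm _ _) (+-congʳ (*-comm _ _))
  *ₚ-comm-suc f g (suc n) = trans (+-congˡ (*ₚ-comm-suc (f ∘ suc) g n)) (x∙yz≈y∙xz _ _ _)

  *ₚ-comm : ∀ f g → f *ₚ g ≋ g *ₚ f
  *ₚ-comm f g zero = *-comm _ _
  *ₚ-comm f g (suc n) = trans (*ₚ-comm-suc f g n) (+-congˡ (*ₚ-comm f (g ∘ suc) n))

  *ₚ-scale : ∀ u f g n → u * (f *ₚ g) n ≈ ((λ i → u * f i) *ₚ g) n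
  *ₚ-scale u f g zero = sym (*-assoc _ _ _)
  *ₚ-scale u f g (suc n) = trans (distribˡ _ _ _) (+-cong (sym (*-assoc _ _ _)) (*ₚ-scale u (f ∘ suc) g n))

  *ₚ-assoc : ∀ f g h → (f *ₚ g) *ₚ h ≋ f *ₚ (g *ₚ h)
  *ₚ-assoc f g h zero = *-assoc _ _ _
  *ₚ-assoc f g h (suc n) = begin
    f 0 * g 0 * h (suc n) + (((λ i → f 0 * g (suc i)) +ₚ (f ∘ suc) *ₚ g) *ₚ h) n
      ≈⟨ +-cong (*-assoc _ _ _) (*ₚ-distribʳ h (λ i → f 0 * g (suc i)) ((f ∘ suc) *ₚ g) n) ⟩
    f 0 * (g 0 * h (suc n)) + (((λ i → f 0 * g (suc i)) *ₚ h) n + (((f ∘ suc) *ₚ g) *ₚ h) n)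
      ≈⟨ +-congˡ (+-cong (sym (*ₚ-scale (f 0) (g ∘ suc) h n)) (*ₚ-assoc (f ∘ suc) g h n)) ⟩
    f 0 * (g 0 * h (suc n)) + (f 0 * ((g ∘ suc) *ₚ h) n + ((f ∘ suc) *ₚ (g *ₚ h)) n)
      ≈⟨ sym (+-assoc _ _ _) ⟩
    (f 0 * (g 0 * h (suc n)) + f 0 * ((g ∘ suc) *ₚ h) n) + ((f ∘ suc) *ₚ (g *ₚ h)) n
      ≈⟨ +-congʳ (sym (distribˡ _ _ _)) ⟩
    f 0 * (g 0 * h (suc n) + ((g ∘ suc) *ₚ h) n) + ((f ∘ suc) *ₚ (g *ₚ h)) n ∎

  *ₚ-identityˡ : ∀ f → 1ₚ *ₚ f ≋ f
  *ₚ-identityˡ f n = trans (const-*ₚ 1# f n) (*-identityˡ _)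

  seriesRing : CommutativeRing a ℓ
  seriesRing = record
    { Carrier = Series ; _≈_ = _≋_ ; _+_ = _+ₚ_ ; _*_ = _*ₚ_ ; -_ = -ₚ_ ; 0# = 0ₚ ; 1# = 1ₚ
    ; isCommutativeRing = record
      { isRing = record
        { +-isAbelianGroup = record
          { isGroup = record
            { isMonoid = record
              { isSemigroup = record
                { isMagma = record
                  { isEquivalence = record
                    { refl = λ n → refl ; sym = λ p n → sym (p n) ; trans = λ p q n → trans (p n) (q n) }
                  ; ∙-cong = λ p q n → +-cong (p n) (q n) }
                ; assoc = λ f g h n → +-assoc _ _ _ }
              ; identity = (λ f n → +-identityˡ _) , (λ f n → +-identityʳ _) }
            ; inverse = (λ f n → -‿inverseˡ _) , (λ f n → -‿inverseʳ _)
            ; ⁻¹-cong = λ p n → -‿cong (p n) }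
          ; comm = λ f g n → +-comm _ _ }
        ; *-cong = *ₚ-cong
        ; *-assoc = *ₚ-assoc
        ; *-identity = *ₚ-identityˡ , λ f n → trans (*ₚ-comm f 1ₚ n) (*ₚ-identityˡ f n)
        ; distrib = (λ h f g n → trans (*ₚ-comm h (f +ₚ g) n) (trans (*ₚ-distribʳ h f g n)
                       (+-cong (*ₚ-comm f h n) (*ₚ-comm g h n))))
                  , *ₚ-distribʳ }
      ; *-comm = *ₚ-comm } }

  infix 4 _≈[_]_
  _≈[_]_ : Series → ℕ → Series → Set ℓ
  f ≈[ n ] g = ∀ i → i < n → f i ≈ g i

  *ₚ-cong-< : ∀ {f f′ g g′} n → f ≈[ n ] f′ → g ≈[ n ] g′ → f *ₚ g ≈[ n ] f′ *ₚ g′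
  *ₚ-cong-< n f≈ g≈ i i<n = *ₚ-cong-≤ i (λ j j≤i → f≈ j (ℕ.≤-<-trans j≤i i<n)) (λ j j≤i → g≈ j (ℕ.≤-<-trans j≤i i<n))

  𝑥-contracts : ∀ {f g} n → f ≈[ n ] g → 𝑥 *ₚ f ≈[ suc n ] 𝑥 *ₚ g
  𝑥-contracts {f} {g} n f≈g zero _ = trans (𝑥-*ₚ-zero f) (sym (𝑥-*ₚ-zero g))
  𝑥-contracts {f} {g} n f≈g (suc i) (s≤s i<n) = trans (𝑥-*ₚ-suc f i) (trans (f≈g i i<n) (sym (𝑥-*ₚ-suc g i)))

  -- Each application of `Φ` makes one more coefficient correct, so the iterates from 0 stabilise:
  -- coefficient n is final after n + 1 rounds.
  module FixedPoint (Φ : Series → Series) (contracts : ∀ {f g} n → f ≈[ n ] g → Φ f ≈[ suc n ] Φ g) where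
    approx : ℕ → Series
    approx zero = 0ₚ
    approx (suc m) = Φ (approx m)

    fix : Series
    fix n = approx (suc n) n

    approx-step : ∀ m → approx m ≈[ m ] approx (suc m)
    approx-step zero i ()
    approx-step (suc m) = contracts m (approx-step m)

    approx-fix : ∀ m → fix ≈[ m ] approx m
    approx-fix (suc m) i i<sm with ℕ.m≤n⇒m<n∨m≡n (ℕ.≤-pred i<sm)
    ... | inj₁ i<m = trans (approx-fix m i i<m) (approx-step m i i<m)
    ... | inj₂ ≡.refl = refl

    fix-fixed : fix ≋ Φ fix
    fix-fixed n = sym (contracts n (approx-fix n) n ℕ.≤-refl)

-- Finite sums and the convolution formula

module FiniteSum {a ℓ : Level} (R : CommutativeRing a ℓ) where
  open CommutativeRing R
  open import Algebra.Properties.CommutativeSemigroup +-commutativeSemigroup using (interchange)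

  ∑ : ℕ → (ℕ → Carrier) → Carrier
  ∑ zero f = f 0
  ∑ (suc n) f = ∑ n f + f (suc n)

  ∑-cong : ∀ n {f g} → (∀ i → i ≤ n → f i ≈ g i) → ∑ n f ≈ ∑ n g
  ∑-cong zero f≈g = f≈g 0 z≤n
  ∑-cong (suc n) f≈g = +-cong (∑-cong n λ i i≤n → f≈g i (ℕ.m≤n⇒m≤1+n i≤n)) (f≈g (suc n) ℕ.≤-refl)

  ∑-front : ∀ n f → ∑ (suc n) f ≈ f 0 + ∑ n (λ i → f (suc i))
  ∑-front zero f = refl
  ∑-front (suc n) f = trans (+-congʳ (∑-front n f)) (+-assoc _ _ _)

  ∑-+ : ∀ n f g → ∑ n (λ i → f i + g i) ≈ ∑ n f + ∑ n g
  ∑-+ zero f g = refl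
  ∑-+ (suc n) f g = trans (+-congʳ (∑-+ n f g)) (interchange _ _ _ _)

  ∑-*ˡ : ∀ n u f → ∑ n (λ i → u * f i) ≈ u * ∑ n f
  ∑-*ˡ zero u f = refl
  ∑-*ˡ (suc n) u f = trans (+-congʳ (∑-*ˡ n u f)) (sym (distribˡ _ _ _))

module Convolution {a ℓ : Level} (R : CommutativeRing a ℓ) where
  open CommutativeRing R renaming (trans to ≈-trans; sym to ≈-sym)
  open PowerSeries R using (_*ₚ_)
  open FiniteSum R

  *ₚ-∑ : ∀ f g n → (f *ₚ g) n ≈ ∑ n (λ i → f i * g (n ∸ i))
  *ₚ-∑ f g zero = CommutativeRing.refl R
  *ₚ-∑ f g (suc n) = ≈-trans (+-congˡ (*ₚ-∑ (f ∘ suc) g n)) (≈-sym (∑-front n _))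

-- Solution of the path recurrences by the kernel method

module KernelSolution {a ℓ : Level} (R : CommutativeRing a ℓ) where
  open CommutativeRing R

  module Solution (x y c T : Carrier)
    (c-eq : c ≈ x * ((1# + c) * (1# + y * c))) (T-eq : T ≈ 1# + x * (1# + y + (y * c + y * c)) * T) where

    open FiniteSum R
    open import Relation.Binary.Reasoning.Setoid setoid
    open import Algebra.Solver.Ring.NaturalCoefficients.Default commutativeSemiring
    open import Algebra.Properties.Group +-group using () renaming (∙-cancelʳ to +-cancelʳ)

    -- The characteristic roots are `q` and `1 / t`, and `θ` is their quotient. `κ` is the
    -- derivative of `x (1 + c) (1 + y c)` with respect to `c`, so `T` is `1 / (1 - κ)`. One has
    -- `1 / p = 1 - t` and `1 / q = 1 - w`.
    q p κ w t θ r K : Carrier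
    q = 1# + c
    p = 1# + y * c
    κ = x * (1# + y + (y * c + y * c))
    w = x * p
    t = x * y * q
    θ = t * q
    r = 1# + t * w * T
    K = x * w

    -- To derive u ≈ v, exhibit u - v as a combination of known relations l - l′,
    -- written without subtraction so that the semiring solver applies.
    combine : ∀ {l l′ u v} → l ≈ l′ → u + l′ ≈ v + l → u ≈ v
    combine {l} {l′} {u} {v} l≈l′ e = +-cancelʳ l′ u v (trans e (+-congˡ l≈l′))

    infixr 7 _∙_
    infixl 6 _⊞_
    _∙_ : ∀ k {l l′} → l ≈ l′ → k * l ≈ k * l′
    k ∙ e = *-congˡ e

    _⊞_ : ∀ {l l′ m m′} → l ≈ l′ → m ≈ m′ → l + m ≈ l′ + m′
    _⊞_ = +-cong

    wq≈c : w * q ≈ c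
    wq≈c = trans (solve 3 (λ x p q → x :* p :* q := x :* (q :* p)) refl x p q) (sym c-eq)

    tp≈yc : t * p ≈ y * c
    tp≈yc = trans (solve 4 (λ x y q p → x :* y :* q :* p := y :* (x :* (q :* p))) refl x y q p) (*-congˡ (sym c-eq))

    -- The condition for `qʰ` to solve the homogeneous difference equation `F (h + 1) - F h = x (y F
    -- (h + 2) - y F (h + 1) + F (h + 1))`.
    kernel : q + x * y * q ≈ 1# + θ + x * q
    kernel = combine c-eq (solve 3 (λ x y c → let q = con 1 :+ c ; p = con 1 :+ y :* c in
      (q :+ x :* y :* q) :+ x :* (q :* p) := (con 1 :+ x :* y :* q :* q :+ x :* q) :+ c) refl x y c)

    T-unique : ∀ u → u ≈ 1# + κ * u → u ≈ T
    T-unique u e = +-cancelʳ (κ * u * T) u T (begin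
      u + κ * u * T     ≈⟨ solve 3 (λ u κ T → u :+ κ :* u :* T := u :* (con 1 :+ κ :* T)) refl u κ T ⟩
      u * (1# + κ * T)  ≈⟨ *-congˡ (sym T-eq) ⟩
      u * T             ≈⟨ *-congʳ e ⟩
      (1# + κ * u) * T  ≈⟨ solve 3 (λ u κ T → (con 1 :+ κ :* u) :* T := T :+ κ :* u :* T) refl u κ T ⟩
      T + κ * u * T     ∎)

    -- The hypothesis is `u (1 - κ) = 1 - v` and the conclusion `u = T (1 - v)`, both freed of
    -- subtraction.
    T-unique-affine : ∀ u v → u + v ≈ 1# + κ * u → u + v * T ≈ T
    T-unique-affine u v e = T-unique (u + v * T) (begin
      u + v * T                    ≈⟨ +-congˡ (*-congˡ T-eq) ⟩
      u + v * (1# + κ * T)         ≈⟨ solve 4 (λ u v κ T → u :+ v :* (con 1 :+ κ :* T) := (u :+ v) :+ v :* κ :* T) refl u v κ T ⟩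
      (u + v) + v * κ * T          ≈⟨ +-congʳ e ⟩
      (1# + κ * u) + v * κ * T     ≈⟨ solve 4 (λ u v κ T → (con 1 :+ κ :* u) :+ v :* κ :* T := con 1 :+ κ :* (u :+ v :* T)) refl u v κ T ⟩
      1# + κ * (u + v * T)         ∎)

    -- In the form `T = q / (1 - θ)` this is the source of every factor `T` in the solutions below.
    T≈q+θT : T ≈ q + θ * T
    T≈q+θT = sym (T-unique-affine q θ (combine c-eq (solve 3 (λ x y c →
      let q = con 1 :+ c ; p = con 1 :+ y :* c ; κ = x :* (con 1 :+ y :+ (y :* c :+ y :* c)) in
      (q :+ x :* y :* q :* q) :+ x :* (q :* p) := (con 1 :+ κ :* q) :+ c) refl x y c)))

    -- Since `x p q = c`, the left side equals `p q + y c² T`, to which `T-unique-affine` applies.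
    pqr≈T : p * q * r ≈ T
    pqr≈T = begin
      p * q * r                                        ≈⟨ solve 5 (λ x y p q T →
          p :* q :* (con 1 :+ x :* y :* q :* (x :* p) :* T) := q :* p :+ y :* (x :* (q :* p)) :* (x :* (q :* p)) :* T) refl x y p q T ⟩
      q * p + y * (x * (q * p)) * (x * (q * p)) * T    ≈⟨ +-congˡ (*-congʳ (*-cong (*-congˡ (sym c-eq)) (sym c-eq))) ⟩
      q * p + y * c * c * T                            ≈⟨ T-unique-affine (q * p) (y * c * c)
          (combine ((1# + y + (y * c + y * c)) ∙ c-eq) (solve 3 (λ x y c →
            let q = con 1 :+ c ; p = con 1 :+ y :* c ; k = con 1 :+ y :+ (y :* c :+ y :* c) in
            (q :* p :+ y :* c :* c) :+ k :* (x :* (q :* p)) := (con 1 :+ x :* k :* (q :* p)) :+ k :* c) refl x y c)) ⟩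
      T ∎

    infixr 8 q^_
    q^_ : ℕ → Carrier
    q^ zero = 1#
    q^ suc n = q * q^ n

    q^-+ : ∀ m n → q^ (m ℕ.+ n) ≈ q^ m * q^ n
    q^-+ zero n = sym (*-identityˡ _)
    q^-+ (suc m) n = trans (*-congˡ (q^-+ m n)) (sym (*-assoc _ _ _))

    -- Subtracting consecutive instances turns the recurrence with a partial sum into one with three terms.
    solves : ∀ (F G : ℕ → Carrier) → F 0 ≈ G 0 + x * (y * F 1 + F 0) →
      (∀ h → F (suc h) + x * y * F (suc h) + G h ≈ F h + x * y * F (suc (suc h)) + x * F (suc h) + G (suc h)) →
      ∀ h → F h ≈ G h + x * (y * F (suc h) + ∑ h F)
    solves F G base step zero = base
    solves F G base step (suc h) = combine (step h ⊞ solves F G base step h)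
      (solve 8 (λ x y f f′ f″ g g′ s →
        f′ :+ ((f :+ x :* y :* f″ :+ x :* f′ :+ g′) :+ (g :+ x :* (y :* f′ :+ s)))
        := (g′ :+ x :* (y :* f″ :+ (s :+ f′))) :+ ((f′ :+ x :* y :* f′ :+ g) :+ f)) refl
        x y (F h) (F (suc h)) (F (suc (suc h))) (G h) (G (suc h)) (∑ h F))

    ν : ℕ → Carrier
    ν zero = 0#
    ν (suc n) = ν n + 1#

    -- From h + 1 accessible blocks: W h counts the paths without a gluing, B h m those that glue a given
    -- face with m block minima, up to the factor m, and A h those that glue a face cut off later on.
    W : ℕ → Carrier
    W h = p * q^ suc h

    -- The constant source disappears in differences, leaving the kernel; the base case fixes the
    -- factor `p = 1 / (1 - t)`.
    W-rec : ∀ h → W h ≈ 1# + x * (y * W (suc h) + ∑ h W)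
    W-rec = solves W (λ _ → 1#)
      (combine ((1# + y * q) ∙ c-eq) (solve 3 (λ x y c →
        let q = con 1 :+ c ; p = con 1 :+ y :* c ; q¹ = q :* con 1 ; k = con 1 :+ y :* q in
        p :* q¹ :+ k :* (x :* (q :* p)) := (con 1 :+ x :* (y :* (p :* (q :* q¹)) :+ p :* q¹)) :+ k :* c) refl x y c))
      (λ h → combine ((p * q^ suc h) ∙ kernel) (solve 5 (λ x y p q Q →
        let k = p :* (q :* Q) ; F′ = p :* (q :* (q :* Q)) in
        (F′ :+ x :* y :* F′ :+ con 1) :+ k :* (con 1 :+ x :* y :* q :* q :+ x :* q)
        := (p :* (q :* Q) :+ x :* y :* (p :* (q :* (q :* (q :* Q)))) :+ x :* F′ :+ con 1) :+ k :* (q :+ x :* y :* q)) refl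
        x y p q (q^ h)))

    B : ℕ → ℕ → Carrier
    B h m = w * T * q^ m * q^ suc h * (1# + ν h * w)

    -- The difference equation of `B`, divided by `w * q^ m * q^ suc h`, with `N` standing for
    -- `1 + h w`.
    B-step : ∀ N → T * q * (N + w) * (1# + x * y) + 1# ≈ T * N + T * θ * (N + w + w) + x * q * T * (N + w) + q
    B-step N = combine ((T * (N + w)) ∙ kernel ⊞ w ∙ T≈q+θT ⊞ wq≈c) (solve 7 (λ x y c T N w θ → let q = con 1 :+ c in
      (T :* q :* (N :+ w) :* (con 1 :+ x :* y) :+ con 1)
        :+ (T :* (N :+ w) :* (con 1 :+ θ :+ x :* q) :+ w :* (q :+ θ :* T) :+ c)
      := (T :* N :+ T :* θ :* (N :+ w :+ w) :+ x :* q :* T :* (N :+ w) :+ q)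
        :+ (T :* (N :+ w) :* (q :+ x :* y :* q) :+ w :* T :+ w :* q)) refl x y c T N w θ)

    -- The source `x W (h + m)` is a multiple of `qʰ`, which already solves the homogeneous
    -- equation; this resonance forces the factor linear in `h`.
    B-rec : ∀ m h → B h m ≈ x * W (h ℕ.+ m) + x * (y * B (suc h) m + ∑ h (λ j → B j m))
    B-rec m h = trans (solves (λ h → B h m) (λ h → w * q^ m * q^ suc h) base step h) (+-congʳ (sym source))
      where
      source : x * W (h ℕ.+ m) ≈ w * q^ m * q^ suc h
      source = trans (*-congˡ (*-congˡ (*-congˡ (q^-+ h m)))) (solve 5 (λ x p q Q M →
        x :* (p :* (q :* (Q :* M))) := x :* p :* M :* (q :* Q)) refl x p q (q^ h) (q^ m))
      base : B 0 m ≈ w * q^ m * q^ 1 + x * (y * B 1 m + B 0 m)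
      base = combine ((w * q^ m * q) ∙ T-eq ⊞ (w * q^ m * q * T * x * y) ∙ sym wq≈c) (solve 6 (λ x y c w T M →
        let q = con 1 :+ c ; q¹ = q :* con 1 ; k = w :* M :* q ; k′ = k :* T :* x :* y ; B0 = w :* T :* M :* q¹ :* (con 1 :+ con 0 :* w)
            κ = x :* (con 1 :+ y :+ (y :* c :+ y :* c)) in
        B0 :+ (k :* (con 1 :+ κ :* T) :+ k′ :* (w :* q))
        := (w :* M :* q¹ :+ x :* (y :* (w :* T :* M :* (q :* q¹) :* (con 1 :+ (con 0 :+ con 1) :* w)) :+ B0)) :+ (k :* T :+ k′ :* c)) refl
        x y c w T (q^ m))
      step : ∀ h → B (suc h) m + x * y * B (suc h) m + w * q^ m * q^ suc h
        ≈ B h m + x * y * B (suc (suc h)) m + x * B (suc h) m + w * q^ m * q^ suc (suc h)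
      step h = combine ((w * q^ m * q^ suc h) ∙ B-step (1# + ν h * w)) (solve 8 (λ x y q w T n Q M →
        let N = con 1 :+ n :* w ; k = w :* M :* Q
            B′ = w :* T :* M :* (q :* Q) :* (con 1 :+ (n :+ con 1) :* w) in
        (B′ :+ x :* y :* B′ :+ k) :+ k :* (T :* N :+ T :* (x :* y :* q :* q) :* (N :+ w :+ w) :+ x :* q :* T :* (N :+ w) :+ q)
        := (w :* T :* M :* Q :* N :+ x :* y :* (w :* T :* M :* (q :* (q :* Q)) :* (con 1 :+ (n :+ con 1 :+ con 1) :* w)) :+ x :* B′ :+ w :* M :* (q :* Q))
          :+ k :* (T :* q :* (N :+ w) :* (con 1 :+ x :* y) :+ con 1)) refl x y q w T (ν h) (q^ suc h) (q^ m))

    -- n₁ h, n₂ h, n₃ h are the binomial coefficients of h + 1 over 1, 2, 3.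
    n₁ n₂ n₃ : ℕ → Carrier
    n₁ zero = 1#
    n₁ (suc h) = n₁ h + 1#
    n₂ zero = 0#
    n₂ (suc h) = n₂ h + n₁ h
    n₃ zero = 0#
    n₃ (suc h) = n₃ h + n₂ h

    σ : ℕ → Carrier
    σ h = n₂ h + n₃ h * w

    n₁≈ν : ∀ h → n₁ h ≈ ν (suc h)
    n₁≈ν zero = sym (+-identityˡ _)
    n₁≈ν (suc h) = +-congʳ (n₁≈ν h)

    ∑-linear : ∀ h → ∑ h (λ j → 1# + ν j * w) ≈ n₁ h + n₂ h * w
    ∑-linear zero = refl
    ∑-linear (suc h) = begin
      ∑ h (λ j → 1# + ν j * w) + (1# + ν (suc h) * w)  ≈⟨ +-cong (∑-linear h) (+-congˡ (*-congʳ (sym (n₁≈ν h)))) ⟩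
      (n₁ h + n₂ h * w) + (1# + n₁ h * w)              ≈⟨ solve 3 (λ n₁ n₂ w →
        (n₁ :+ n₂ :* w) :+ (con 1 :+ n₁ :* w) := (n₁ :+ con 1) :+ (n₂ :+ n₁) :* w) refl (n₁ h) (n₂ h) w ⟩
      n₁ (suc h) + n₂ (suc h) * w                      ∎

    ν-suc-∸ : ∀ h j → j ≤ h → ν (suc h ∸ j) ≡ ν (h ∸ j) + 1#
    ν-suc-∸ h j j≤h = ≡.cong ν (ℕ.+-∸-assoc 1 j≤h)

    -- The sums of `h - j` and of `(h - j) j` are the binomial coefficients of h + 1 over 2 and over
    -- 3. Raising `h` by one adds `∑-linear`.
    ∑-weighted : ∀ h → ∑ h (λ j → ν (h ∸ j) * (1# + ν j * w)) ≈ σ h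
    ∑-weighted zero = solve 1 (λ w → con 0 :* (con 1 :+ con 0 :* w) := con 0 :+ con 0 :* w) refl w
    ∑-weighted (suc h) = begin
      ∑ h (λ j → ν (suc h ∸ j) * b j) + ν (h ∸ h) * b (suc h)
        ≈⟨ +-cong (∑-cong h λ j j≤h → trans (*-congʳ (reflexive (ν-suc-∸ h j j≤h))) (trans (distribʳ _ _ _) (+-congˡ (*-identityˡ _))))
                  (trans (*-congʳ (reflexive (≡.cong ν (ℕ.n∸n≡0 h)))) (zeroˡ _)) ⟩
      ∑ h (λ j → ν (h ∸ j) * b j + b j) + 0#      ≈⟨ +-identityʳ _ ⟩
      ∑ h (λ j → ν (h ∸ j) * b j + b j)           ≈⟨ ∑-+ h _ _ ⟩
      ∑ h (λ j → ν (h ∸ j) * b j) + ∑ h b         ≈⟨ +-cong (∑-weighted h) (∑-linear h) ⟩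
      (n₂ h + n₃ h * w) + (n₁ h + n₂ h * w)       ≈⟨ solve 4 (λ n₁ n₂ n₃ w →
        (n₂ :+ n₃ :* w) :+ (n₁ :+ n₂ :* w) := (n₂ :+ n₁) :+ (n₃ :+ n₂) :* w) refl (n₁ h) (n₂ h) (n₃ h) w ⟩
      σ (suc h) ∎
      where
      b : ℕ → Carrier
      b j = 1# + ν j * w

    -- A cut distributes the h + 1 minima over two faces, so the powers of `q` in `B j (h - j)`
    -- always multiply to `qʰ⁺¹` and only the polynomial weights are summed.
    source : ∀ h → ∑ h (λ j → ν (h ∸ j) * B j (h ∸ j)) ≈ w * T * q^ suc h * σ h
    source h = begin
      ∑ h (λ j → ν (h ∸ j) * B j (h ∸ j))                                ≈⟨ ∑-cong h summand ⟩
      ∑ h (λ j → w * T * q^ suc h * (ν (h ∸ j) * (1# + ν j * w)))        ≈⟨ ∑-*ˡ h _ _ ⟩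
      w * T * q^ suc h * ∑ h (λ j → ν (h ∸ j) * (1# + ν j * w))          ≈⟨ *-congˡ (∑-weighted h) ⟩
      w * T * q^ suc h * σ h                                              ∎
      where
      summand : ∀ j → j ≤ h → ν (h ∸ j) * B j (h ∸ j) ≈ w * T * q^ suc h * (ν (h ∸ j) * (1# + ν j * w))
      summand j j≤h = begin
        ν (h ∸ j) * B j (h ∸ j)
          ≈⟨ solve 7 (λ n w T M q Q b → n :* (w :* T :* M :* (q :* Q) :* b) := w :* T :* (q :* (M :* Q)) :* (n :* b)) refl
               (ν (h ∸ j)) w T (q^ (h ∸ j)) q (q^ j) (1# + ν j * w) ⟩
        w * T * (q * (q^ (h ∸ j) * q^ j)) * (ν (h ∸ j) * (1# + ν j * w))
          ≈⟨ *-congʳ (*-congˡ (*-congˡ (trans (sym (q^-+ (h ∸ j) j)) (reflexive (≡.cong q^_ (ℕ.m∸n+n≡m j≤h)))))) ⟩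
        w * T * q^ suc h * (ν (h ∸ j) * (1# + ν j * w)) ∎

    -- α is determined by α h * q^ suc h = A h; comparing the coefficients of n₃, n₂, n₁, 1 in the
    -- recurrence of its differences e gives the triangular system δ₃-eq, …, δ₀-eq.
    δ₀ δ₁ δ₂ δ₃ : Carrier
    δ₀ = t * T * (T * (r * r))
    δ₁ = T * (r * r)
    δ₂ = T * w * (1# + r)
    δ₃ = w * w * T

    e : ℕ → Carrier
    e h = K * T * (δ₀ + δ₁ * n₁ h + δ₂ * n₂ h + δ₃ * n₃ h)

    -- The system is solved from the top coefficient down, each time dividing by `1 - θ = q / T`.
    -- The combination `r = 1 + t w T` first appears when `θ * δ₃` feeds into the equation for `δ₂`.
    δ₃-eq : δ₃ + w ≈ θ * δ₃ + q * w
    δ₃-eq = combine ((w * w) ∙ T≈q+θT ⊞ w ∙ wq≈c) (solve 4 (λ w T θ c → let q = con 1 :+ c in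
      (w :* w :* T :+ w) :+ (w :* w :* (q :+ θ :* T) :+ w :* c)
      := (θ :* (w :* w :* T) :+ q :* w) :+ (w :* w :* T :+ w :* (w :* q))) refl w T θ c)

    δ₂-eq : δ₂ + 1# ≈ θ * (δ₂ + δ₃) + q * (1# + w)
    δ₂-eq = combine ((w * (1# + r)) ∙ T≈q+θT ⊞ wq≈c) (solve 4 (λ w T t c →
      let q = con 1 :+ c ; θ = t :* q ; r = con 1 :+ t :* w :* T ; δ₂ = T :* w :* (con 1 :+ r) in
      (δ₂ :+ con 1) :+ (w :* (con 1 :+ r) :* (q :+ θ :* T) :+ c)
      := (θ :* (δ₂ :+ w :* w :* T) :+ q :* (con 1 :+ w)) :+ (w :* (con 1 :+ r) :* T :+ w :* q)) refl w T t c)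

    δ₁-eq : δ₁ ≈ θ * (δ₁ + δ₂) + q
    δ₁-eq = combine ((r * r) ∙ T≈q+θT) (solve 4 (λ w T t q →
      let θ = t :* q ; r = con 1 :+ t :* w :* T ; δ₁ = T :* (r :* r) in
      δ₁ :+ r :* r :* (q :+ θ :* T) := (θ :* (δ₁ :+ T :* w :* (con 1 :+ r)) :+ q) :+ r :* r :* T) refl w T t q)

    δ₀-eq : δ₀ ≈ θ * (δ₀ + δ₁)
    δ₀-eq = combine ((t * T * (r * r)) ∙ T≈q+θT) (solve 4 (λ r T t q →
      let θ = t :* q ; δ₁ = T :* (r :* r) ; δ₀ = t :* T :* δ₁ in
      δ₀ :+ t :* T :* (r :* r) :* (q :+ θ :* T) := θ :* (δ₀ :+ δ₁) :+ t :* T :* (r :* r) :* T) refl r T t q)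

    e-step : ∀ h → e h + K * T * σ h ≈ θ * e (suc h) + K * T * q * σ (suc h)
    e-step h = combine ((K * T * n₃ h) ∙ δ₃-eq ⊞ (K * T * n₂ h) ∙ δ₂-eq ⊞ (K * T * n₁ h) ∙ δ₁-eq ⊞ (K * T) ∙ δ₀-eq)
      (solve 12 (λ K T q w θ δ₀ δ₁ δ₂ δ₃ n₁ n₂ n₃ →
        (K :* T :* (δ₀ :+ δ₁ :* n₁ :+ δ₂ :* n₂ :+ δ₃ :* n₃) :+ K :* T :* (n₂ :+ n₃ :* w))
          :+ (K :* T :* n₃ :* (θ :* δ₃ :+ q :* w) :+ K :* T :* n₂ :* (θ :* (δ₂ :+ δ₃) :+ q :* (con 1 :+ w))
              :+ K :* T :* n₁ :* (θ :* (δ₁ :+ δ₂) :+ q) :+ K :* T :* (θ :* (δ₀ :+ δ₁)))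
        := (θ :* (K :* T :* (δ₀ :+ δ₁ :* (n₁ :+ con 1) :+ δ₂ :* (n₂ :+ n₁) :+ δ₃ :* (n₃ :+ n₂)))
              :+ K :* T :* q :* ((n₂ :+ n₁) :+ (n₃ :+ n₂) :* w))
          :+ (K :* T :* n₃ :* (δ₃ :+ w) :+ K :* T :* n₂ :* (δ₂ :+ con 1) :+ K :* T :* n₁ :* δ₁ :+ K :* T :* δ₀)) refl
        K T q w θ δ₀ δ₁ δ₂ δ₃ (n₁ h) (n₂ h) (n₃ h))

    α : ℕ → Carrier
    -- The recurrence at height 0 reads `α 0 (1 - x - t) = t e 0`. By `kernel`,
    -- `q (1 - x - t) = 1 - t = 1 / p`, so `α 0 = p θ e 0`, which `δ₀-eq` simplifies.
    α zero = p * (K * T * δ₀)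
    α (suc h) = α h + e h

    A : ℕ → Carrier
    A h = α h * q^ suc h

    -- Divided by `qʰ⁺¹`, the difference equation involves `α` only through its differences because
    -- of `kernel`; what remains is the first-order equation `e-step`.
    A-rec : ∀ h → A h ≈ x * ∑ h (λ j → ν (h ∸ j) * B j (h ∸ j)) + x * (y * A (suc h) + ∑ h A)
    A-rec h = trans (solves A (λ h → K * T * q^ suc h * σ h) base step h)
      (+-congʳ (trans (solve 5 (λ x w T Q s → x :* w :* T :* Q :* s := x :* (w :* T :* Q :* s)) refl x w T (q^ suc h) (σ h))
        (*-congˡ (sym (source h)))))
      where
      base : A 0 ≈ K * T * q^ 1 * σ 0 + x * (y * A 1 + A 0)
      base = combine ((q * K * T * t * δ₁) ∙ T-eq ⊞ (q * K * T * t * δ₁ * T) ∙ sym tp≈yc) (solve 9 (λ x y c T K d w δ₂ δ₃ →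
        let q = con 1 :+ c ; p = con 1 :+ y :* c ; t = x :* y :* q ; k = q :* K :* T :* t :* d ; q¹ = q :* con 1
            κ = x :* (con 1 :+ y :+ (y :* c :+ y :* c)) ; d₀ = t :* T :* d ; a = p :* (K :* T :* d₀) in
        a :* q¹ :+ (k :* (con 1 :+ κ :* T) :+ k :* T :* (t :* p))
        := (K :* T :* q¹ :* (con 0 :+ con 0 :* w) :+ x :* (y :* ((a :+ K :* T :* (d₀ :+ d :* con 1 :+ δ₂ :* con 0 :+ δ₃ :* con 0)) :* (q :* q¹)) :+ a :* q¹))
           :+ (k :* T :+ k :* T :* (y :* c))) refl x y c T K δ₁ w δ₂ δ₃)
      step : ∀ h → A (suc h) + x * y * A (suc h) + K * T * q^ suc h * σ h
        ≈ A h + x * y * A (suc (suc h)) + x * A (suc h) + K * T * q^ suc (suc h) * σ (suc h)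
      step h = combine ((q^ suc h * (α h + e h)) ∙ kernel ⊞ q^ suc h ∙ e-step h) (solve 10 (λ x y q Q k a e e′ s s′ →
        let θ = x :* y :* q :* q ; A′ = (a :+ e) :* (q :* Q) in
        (A′ :+ x :* y :* A′ :+ k :* Q :* s) :+ (Q :* (a :+ e) :* (con 1 :+ θ :+ x :* q) :+ Q :* (θ :* e′ :+ k :* q :* s′))
        := (a :* Q :+ x :* y :* ((a :+ e :+ e′) :* (q :* (q :* Q))) :+ x :* A′ :+ k :* (q :* Q) :* s′)
          :+ (Q :* (a :+ e) :* (q :+ x :* y :* q) :+ Q :* (e :+ k :* s))) refl
        x y q (q^ suc h) (K * T) (α h) (e h) (e (suc h)) (σ h) (σ (suc h)))

    -- U h M, h + 1 and M counting the block minima on the outer face and on the others,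
    -- is affine in M because the genus is raised by joining exactly one of these other faces.
    U jumps : ℕ → List ℕ → Carrier
    U h [] = A h
    U h (m ∷ M) = ν m * B h m + U h M
    jumps h [] = 0#
    jumps h (m ∷ M) = ν m * W (h ℕ.+ m) + jumps h M

    -- Each face present in `M` obeys its own `B-rec`. A face cut off at `j` enters the list with
    -- the term `ν (h ∸ j) * B j (h ∸ j)`, and these terms are the source in `A-rec`.
    U-rec : ∀ h M → U h M ≈ x * (y * U (suc h) M + (∑ h (λ j → U j (h ∸ j ∷ M)) + jumps h M))
    U-rec h [] = begin
      A h ≈⟨ A-rec h ⟩
      x * ∑ h (λ j → ν (h ∸ j) * B j (h ∸ j)) + x * (y * A (suc h) + ∑ h A)
        ≈⟨ solve 4 (λ x s f a → x :* s :+ x :* (f :+ a) := x :* (f :+ (s :+ a :+ con 0))) refl x _ (y * A (suc h)) _ ⟩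
      x * (y * A (suc h) + (∑ h (λ j → ν (h ∸ j) * B j (h ∸ j)) + ∑ h A + 0#))
        ≈⟨ *-congˡ (+-congˡ (+-congʳ (sym (∑-+ h _ _)))) ⟩
      x * (y * A (suc h) + (∑ h (λ j → ν (h ∸ j) * B j (h ∸ j) + A j) + 0#)) ∎
    U-rec h (m ∷ M) = begin
      ν m * B h m + U h M
        ≈⟨ +-cong (*-congˡ (B-rec m h)) (U-rec h M) ⟩
      ν m * (x * W (h ℕ.+ m) + x * (y * B (suc h) m + ∑ h (λ j → B j m)))
        + x * (y * U (suc h) M + (∑ h (λ j → U j (h ∸ j ∷ M)) + jumps h M))
        ≈⟨ solve 9 (λ n x w y b sb u su g →
             n :* (x :* w :+ x :* (y :* b :+ sb)) :+ x :* (y :* u :+ (su :+ g))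
             := x :* (y :* (n :* b :+ u) :+ ((n :* sb :+ su) :+ (n :* w :+ g)))) refl
             (ν m) x (W (h ℕ.+ m)) y (B (suc h) m) (∑ h (λ j → B j m)) (U (suc h) M) (∑ h (λ j → U j (h ∸ j ∷ M))) (jumps h M) ⟩
      x * (y * U (suc h) (m ∷ M) + (ν m * ∑ h (λ j → B j m) + ∑ h (λ j → U j (h ∸ j ∷ M)) + jumps h (m ∷ M)))
        ≈⟨ *-congˡ (+-congˡ (+-congʳ sums)) ⟩
      x * (y * U (suc h) (m ∷ M) + (∑ h (λ j → U j (h ∸ j ∷ m ∷ M)) + jumps h (m ∷ M))) ∎
      where
      sums : ν m * ∑ h (λ j → B j m) + ∑ h (λ j → U j (h ∸ j ∷ M)) ≈ ∑ h (λ j → U j (h ∸ j ∷ m ∷ M))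
      sums = begin
        ν m * ∑ h (λ j → B j m) + ∑ h (λ j → U j (h ∸ j ∷ M))    ≈⟨ +-congʳ (sym (∑-*ˡ h _ _)) ⟩
        ∑ h (λ j → ν m * B j m) + ∑ h (λ j → U j (h ∸ j ∷ M))    ≈⟨ sym (∑-+ h _ _) ⟩
        ∑ h (λ j → ν m * B j m + (ν (h ∸ j) * B j (h ∸ j) + U j M))
          ≈⟨ ∑-cong h (λ j _ → solve 3 (λ a b u → a :+ (b :+ u) := b :+ (a :+ u)) refl _ _ _) ⟩
        ∑ h (λ j → U j (h ∸ j ∷ m ∷ M)) ∎

    T⁵ : Carrier
    T⁵ = T * (T * (T * (T * T)))

    -- The outer `x y` is the first point, which opens a block of its own. Unfolded, `A 0` is
    -- `x³ y (p q r)² T³`, whence the exponent 5.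
    xyA₀≈x⁴y²T⁵ : x * (y * A 0) ≈ x * (x * (x * (x * (y * (y * T⁵)))))
    xyA₀≈x⁴y²T⁵ = begin
      x * (y * A 0)
        ≈⟨ solve 6 (λ x y p q r T → x :* (y :* (p :* (x :* (x :* p) :* T :* (x :* y :* q :* T :* (T :* (r :* r)))) :* (q :* con 1)))
             := x :* (x :* (x :* (x :* (y :* (y :* ((p :* q :* r) :* ((p :* q :* r) :* (T :* (T :* T)))))))))) refl x y p q r T ⟩
      x * (x * (x * (x * (y * (y * ((p * q * r) * ((p * q * r) * (T * (T * T)))))))))
        ≈⟨ *-congˡ (*-congˡ (*-congˡ (*-congˡ (*-congˡ (*-congˡ (*-cong pqr≈T (*-congʳ pqr≈T))))))) ⟩
      x * (x * (x * (x * (y * (y * T⁵))))) ∎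

    discriminant : Carrier
    discriminant = (1# - ((1# + y) * x + (1# + y) * x)) + (x * x) * ((1# - y) * (1# - y))

    -- This says `D = (1 - κ)²`. The quadratic `x y c² + (x + x y - 1) c + x` vanishes and has
    -- derivative `κ - 1`; the square of the derivative at a root is the discriminant. Completing
    -- the square explains the multiple `4 x y` of `c-eq`.
    discriminant-κ : discriminant + (κ + κ) ≈ 1# + κ * κ
    discriminant-κ = combine
      (-‿inverseʳ s ⊞ (x * x * (1# + 1# + - y)) ∙ -‿inverseʳ y ⊞ (x * x * y) ∙ sym (-‿inverseʳ y)
        ⊞ (x * y + x * y + x * y + x * y) ∙ c-eq)
      (solve 5 (λ x y c y⁻ s⁻ →
        let q = con 1 :+ c ; p = con 1 :+ y :* c ; κ = x :* (con 1 :+ y :+ (y :* c :+ y :* c))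
            s = (con 1 :+ y) :* x :+ (con 1 :+ y) :* x ; k = x :* x :* (con 1 :+ con 1 :+ y⁻) ; k′ = x :* y :+ x :* y :+ x :* y :+ x :* y in
        ((con 1 :+ s⁻) :+ (x :* x) :* ((con 1 :+ y⁻) :* (con 1 :+ y⁻)) :+ (κ :+ κ))
          :+ (con 0 :+ k :* con 0 :+ x :* x :* y :* (y :+ y⁻) :+ k′ :* (x :* (q :* p)))
        := (con 1 :+ κ :* κ) :+ ((s :+ s⁻) :+ k :* (y :+ y⁻) :+ x :* x :* y :* con 0 :+ k′ :* c)) refl x y c (- y) (- s))
      where
      s : Carrier
      s = (1# + y) * x + (1# + y) * x

    T²-discriminant : (T * T) * discriminant ≈ 1#
    T²-discriminant = +-cancelʳ ((T * T) * (κ + κ)) _ _ (begin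
      (T * T) * discriminant + (T * T) * (κ + κ)  ≈⟨ sym (distribˡ _ _ _) ⟩
      (T * T) * (discriminant + (κ + κ))          ≈⟨ *-congˡ discriminant-κ ⟩
      (T * T) * (1# + κ * κ)                      ≈⟨ solve 2 (λ T κ → (T :* T) :* (con 1 :+ κ :* κ) := T :* T :+ κ :* T :* (κ :* T)) refl T κ ⟩
      T * T + κ * T * (κ * T)                     ≈⟨ +-congʳ (*-cong T-eq T-eq) ⟩
      (1# + κ * T) * (1# + κ * T) + κ * T * (κ * T)
        ≈⟨ solve 1 (λ u → (con 1 :+ u) :* (con 1 :+ u) :+ u :* u := con 1 :+ (u :* (con 1 :+ u) :+ u :* (con 1 :+ u))) refl (κ * T) ⟩
      1# + (κ * T * (1# + κ * T) + κ * T * (1# + κ * T))  ≈⟨ +-congˡ (+-cong (*-congˡ (sym T-eq)) (*-congˡ (sym T-eq))) ⟩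
      1# + (κ * T * T + κ * T * T)                ≈⟨ solve 2 (λ T κ → con 1 :+ (κ :* T :* T :+ κ :* T :* T) := con 1 :+ (T :* T) :* (κ :+ κ)) refl T κ ⟩
      1# + (T * T) * (κ + κ) ∎)

    T⁵-discriminant : T⁵ * T⁵ * discriminant * discriminant * discriminant * discriminant * discriminant ≈ 1#
    T⁵-discriminant = begin
      T⁵ * T⁵ * discriminant * discriminant * discriminant * discriminant * discriminant
        ≈⟨ solve 2 (λ T d → let T⁵ = T :* (T :* (T :* (T :* T))) ; e = (T :* T) :* d in
             T⁵ :* T⁵ :* d :* d :* d :* d :* d := e :* (e :* (e :* (e :* e)))) refl T discriminant ⟩
      E * (E * (E * (E * E)))
        ≈⟨ *-cong E≈1 (*-cong E≈1 (*-cong E≈1 (*-cong E≈1 E≈1))) ⟩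
      1# * (1# * (1# * (1# * 1#)))
        ≈⟨ solve 0 (con 1 :* (con 1 :* (con 1 :* (con 1 :* con 1))) := con 1) refl ⟩
      1# ∎
      where
      E = (T * T) * discriminant
      E≈1 = T²-discriminant

-- Existence of the series `c` and `T`

module KernelSeries {a ℓ : Level} (R : CommutativeRing a ℓ) (u : CommutativeRing.Carrier R) where
  open PowerSeries R
  open CommutativeRing seriesRing hiding (refl; sym; trans)
  module R = CommutativeRing R

  y : Series
  y = const u

  module c-fix = FixedPoint (λ f → 𝑥 * ((1# + f) * (1# + y * f))) (λ {f} {g} n f≈g →
    𝑥-contracts n (*ₚ-cong-< n (λ i i<n → R.+-congˡ (f≈g i i<n))
      (λ i i<n → R.+-congˡ (*ₚ-cong-< n (λ _ _ → R.refl) f≈g i i<n))))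

  c : Series
  c = c-fix.fix

  -- The brackets put `𝑥` outermost, where `𝑥-contracts` applies; `T-eq` reassociates afterwards.
  module T-fix = FixedPoint (λ f → 1# + 𝑥 * ((1# + y + (y * c + y * c)) * f)) (λ {f} {g} n f≈g i i<n →
    R.+-congˡ (𝑥-contracts n (*ₚ-cong-< n (λ _ _ → R.refl) f≈g) i i<n))

  T : Series
  T = T-fix.fix

  c-eq : c ≈ 𝑥 * ((1# + c) * (1# + y * c))
  c-eq = c-fix.fix-fixed

  T-eq : T ≈ 1# + 𝑥 * (1# + y + (y * c + y * c)) * T
  T-eq n = R.trans (T-fix.fix-fixed n) (R.+-congˡ (R.sym (*ₚ-assoc 𝑥 _ T n)))

open import Data.Bool using (Bool; true; false; if_then_else_; _∧_; T; T?)
open import Data.Bool.ListAction using (and)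
open import Data.Bool.Properties using (T-≡; T-∧)
open import Data.Empty using (⊥)
import Data.List.Properties as List
open import Data.List.Membership.Propositional using (_∈_)
open import Data.List.Membership.Propositional.Properties using (∈-∃++; ∈-upTo⁺; ∈-upTo⁻)
open import Data.List.Relation.Unary.All as All using (All; []; _∷_)
import Data.List.Relation.Unary.All.Properties as All
open import Data.List.Relation.Unary.AllPairs using ([]; _∷_)
open import Data.List.Relation.Unary.Any using (here; there)
open import Data.List.Relation.Unary.Unique.Propositional using (Unique)
open import Data.List.Relation.Unary.Unique.Propositional.Properties using (upTo⁺)
open import Data.List.Relation.Binary.Permutation.Propositional using (_↭_; ↭-refl; ↭-sym; ↭-trans; ↭-prep; ↭-reflexive; ↭⇒↭ₛ)
open import Data.List.Relation.Binary.Permutation.Propositional.Properties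
  using (↭-length; ∈-resp-↭; All-resp-↭; filter-↭; map⁺; mapMaybe-↭; ++⁺ˡ; ∷↭∷ʳ; shift; shifts; ++-commutativeMonoid)
  renaming (++-comm to ++-comm-↭)
import Data.List.Relation.Binary.Permutation.Setoid.Properties as Permₛ
open import Data.Maybe using (Maybe; just; nothing)
open import Data.Nat using (_+_; _*_)
open import Data.Nat.ListAction using (sum)
open import Data.Nat.ListAction.Properties using (sum-++; sum-↭)
open import Data.Nat.Properties
open import Data.Nat.Solver using (module +-*-Solver)
open import Data.Unit using (⊤; tt)
open import Relation.Binary using (tri<; tri≈; tri>)
open import Relation.Binary.PropositionalEquality using (refl; sym; trans; cong; cong₂; subst; module ≡-Reasoning)
open import Relation.Nullary using (¬_; contradiction; yes; no)

-- Cycle counts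

T⇒true : ∀ {b} → T b → b ≡ true
T⇒true = Equivalence.to T-≡

true⇒T : ∀ {b} → b ≡ true → T b
true⇒T = Equivalence.from T-≡

data FirstWhere (p : ℕ → Bool) (n : ℕ) : Maybe ℕ → Set where
  found : ∀ w → w < n → T (p w) → (∀ j → j < w → ¬ T (p j)) → FirstWhere p n (just w)
  none : (∀ j → j < n → ¬ T (p j)) → FirstWhere p n nothing

-- Generalised from `upTo` because the tail of `applyUpTo f` is `applyUpTo (f ∘ suc)`.
firstWhere-applyUpTo : ∀ (p : ℕ → Bool) f n →
  (∃ λ w → firstWhere p (applyUpTo f n) ≡ just (f w) × w < n × T (p (f w)) × (∀ j → j < w → ¬ T (p (f j))))
  ⊎ (firstWhere p (applyUpTo f n) ≡ nothing × (∀ j → j < n → ¬ T (p (f j))))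
firstWhere-applyUpTo p f zero = inj₂ (refl , λ j ())
firstWhere-applyUpTo p f (suc n) with p (f 0) in p0
... | true = inj₁ (0 , refl , s≤s z≤n , true⇒T p0 , λ j ())
... | false with firstWhere-applyUpTo p (f ∘ suc) n
... | inj₁ (w , eq , w<n , pw , before) =
  inj₁ (suc w , eq , s≤s w<n , pw , λ { zero _ p0′ → subst T p0 p0′ ; (suc j) (s≤s j<w) → before j j<w })
... | inj₂ (eq , fails) = inj₂ (eq , λ { zero _ p0′ → subst T p0 p0′ ; (suc j) (s≤s j<n) → fails j j<n })

firstWhere-upTo : ∀ p n → FirstWhere p n (firstWhere p (upTo n))
firstWhere-upTo p n with firstWhere p (upTo n) | firstWhere-applyUpTo p id n
... | _ | inj₁ (w , refl , w<n , pw , before) = found w w<n pw before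
... | _ | inj₂ (refl , fails) = none fails

inv-unique : ∀ n π j t → t < n → π t ≡ j → (∀ i → i < n → π i ≡ j → i ≡ t) → inv n π j ≡ t
inv-unique n π j t t<n πt≡j unique with firstWhere (λ i → π i ≡ᵇ j) (upTo n) | firstWhere-upTo (λ i → π i ≡ᵇ j) n
... | _ | found w w<n πw _ = unique w w<n (≡ᵇ⇒≡ _ _ πw)
... | _ | none fails = contradiction (≡⇒≡ᵇ _ _ πt≡j) (fails t t<n)

record Next (s : List ℕ) (t w : ℕ) : Set where
  constructor mkNext
  field
    t<w : t < w
    w<n : w < length s
    same : at s t ≡ at s w
    between : ∀ j → t < j → j < w → at s j ≢ at s t

record First (s : List ℕ) (c w : ℕ) : Set where
  constructor mkFirst
  field
    w<n : w < length s
    label : at s w ≡ c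
    before : ∀ j → j < w → at s j ≢ c

record Last (s : List ℕ) (c t : ℕ) : Set where
  constructor mkLast
  field
    t<n : t < length s
    label : at s t ≡ c
    after : ∀ j → t < j → j < length s → at s j ≢ c

αP-cases : ∀ s t → t < length s → Next s t (αP s t) ⊎ (Last s (at s t) t × First s (at s t) (αP s t))
αP-cases s t t<n
  with firstWhere (λ j → (t <ᵇ j) ∧ (at s j ≡ᵇ at s t)) (upTo (length s))
     | firstWhere-upTo (λ j → (t <ᵇ j) ∧ (at s j ≡ᵇ at s t)) (length s)
... | _ | found w w<n pw before = let t<w , same = Equivalence.to (T-∧ {t <ᵇ w}) pw in
  inj₁ (mkNext (<ᵇ⇒< t w t<w) w<n (sym (≡ᵇ⇒≡ _ _ same))
    (λ j t<j j<w eq → before j j<w (Equivalence.from (T-∧ {t <ᵇ j}) (<⇒<ᵇ t<j , ≡⇒≡ᵇ _ _ eq))))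
... | _ | none fails
  with firstWhere (λ j → at s j ≡ᵇ at s t) (upTo (length s)) | firstWhere-upTo (λ j → at s j ≡ᵇ at s t) (length s)
... | _ | found w w<n pw before = inj₂
  ( mkLast t<n refl (λ j t<j j<n eq → fails j j<n (Equivalence.from (T-∧ {t <ᵇ j}) (<⇒<ᵇ t<j , ≡⇒≡ᵇ _ _ eq)))
  , mkFirst w<n (≡ᵇ⇒≡ _ _ pw) (λ j j<w eq → before j j<w (≡⇒≡ᵇ _ _ eq)))
... | _ | none fails′ = contradiction (≡⇒≡ᵇ (at s t) _ refl) (fails′ t t<n)

Next-functional : ∀ {s t w w′} → Next s t w → Next s t w′ → w ≡ w′
Next-functional {w = w} {w′} (mkNext t<w _ same between) (mkNext t<w′ _ same′ between′) with <-cmp w w′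
... | tri< w<w′ _ _ = contradiction (sym same) (between′ w t<w w<w′)
... | tri≈ _ eq _ = eq
... | tri> _ _ w′<w = contradiction (sym same′) (between w′ t<w′ w′<w)

Next-injective : ∀ {s t t′ w} → Next s t w → Next s t′ w → t ≡ t′
Next-injective {t = t} {t′} (mkNext t<w _ same between) (mkNext t′<w _ same′ between′) with <-cmp t t′
... | tri< t<t′ _ _ = contradiction (trans same′ (sym same)) (between t′ t<t′ t′<w)
... | tri≈ _ eq _ = eq
... | tri> _ _ t′<t = contradiction (trans same (sym same′)) (between′ t t′<t t<w)

First-unique : ∀ {s c w w′} → First s c w → First s c w′ → w ≡ w′
First-unique {w = w} {w′} (mkFirst _ label before) (mkFirst _ label′ before′) with <-cmp w w′
... | tri< w<w′ _ _ = contradiction label (before′ w w<w′)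
... | tri≈ _ eq _ = eq
... | tri> _ _ w′<w = contradiction label′ (before w′ w′<w)

Last-unique : ∀ {s c t t′} → Last s c t → Last s c t′ → t ≡ t′
Last-unique {t = t} {t′} (mkLast t<n label after) (mkLast t′<n label′ after′) with <-cmp t t′
... | tri< t<t′ _ _ = contradiction label′ (after t′ t<t′ t′<n)
... | tri≈ _ eq _ = eq
... | tri> _ _ t′<t = contradiction label (after′ t t′<t t<n)

Next⇒¬Last : ∀ {s c t w} → Next s t w → ¬ Last s c t
Next⇒¬Last (mkNext t<w w<n same _) (mkLast _ refl after) = after _ t<w w<n (sym same)

Next⇒¬First : ∀ {s c t w} → Next s t w → ¬ First s c w
Next⇒¬First (mkNext t<w _ same _) (mkFirst _ refl before) = before _ t<w same

-- The label c marks w as the minimum of block c; unlabelled points are not block minima.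
Precedes : List ℕ → ℕ → Maybe ℕ → ℕ → Set
Precedes s t nothing  w = Next s t w
Precedes s t (just c) w = First s c w × Last s c t

Precedes⇒< : ∀ {s t w} m → Precedes s t m w → t < length s
Precedes⇒< nothing  (mkNext t<w w<n _ _) = <-trans t<w w<n
Precedes⇒< (just c) (_ , last) = Last.t<n last

Precedes⇒αP : ∀ {s t w} m → Precedes s t m w → αP s t ≡ w
Precedes⇒αP {s} {t} nothing next with αP-cases s t (<-trans (Next.t<w next) (Next.w<n next))
... | inj₁ next′ = Next-functional next′ next
... | inj₂ (last , _) = contradiction last (Next⇒¬Last next)
Precedes⇒αP {s} {t} (just c) (first , last) with αP-cases s t (Last.t<n last)
... | inj₁ next = contradiction last (Next⇒¬Last next)
... | inj₂ (_ , first′) = First-unique first′ (subst (λ c → First s c _) (sym (Last.label last)) first)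

-- Injectivity of `αP s`, in the form that lets `inv-unique` evaluate the inverse at `w`.
Precedes-unique : ∀ {s t w} m → Precedes s t m w → ∀ i → i < length s → αP s i ≡ w → i ≡ t
Precedes-unique {s} {t} {w} m prec i i<n refl with αP-cases s i i<n
Precedes-unique nothing next _ _ refl | inj₁ next′ = Next-injective next′ next
Precedes-unique nothing next _ _ refl | inj₂ (_ , first) = contradiction first (Next⇒¬First next)
Precedes-unique (just c) (first , _) _ _ refl | inj₁ next = contradiction first (Next⇒¬First next)
Precedes-unique {s} (just c) (first , last) i _ refl | inj₂ (last′ , first′) =
  Last-unique (subst (λ c → Last s c i) (trans (sym (First.label first′)) (First.label first)) last′) last

-- Chains and cycles given by lists

startOr : ∀ {A : Set} → (A → ℕ) → List A → ℕ → ℕ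
startOr # [] v = v
startOr # (x ∷ _) _ = # x

startOr-snoc : ∀ {A : Set} {# : A → ℕ} xs x v → startOr # (xs ++ [ x ]) v ≡ startOr # xs (# x)
startOr-snoc [] x v = refl
startOr-snoc (_ ∷ _) x v = refl

module _ {A : Set} (E : A → ℕ → Set) (# : A → ℕ) where

  -- The target `v` of the last link is left free: chains can then be concatenated, a cycle is a
  -- chain aimed at its own start, and the outer face can be aimed at the next point to be inserted.
  Chain : List A → ℕ → Set
  Chain [] v = ⊤
  Chain (x ∷ xs) v = E x (startOr # xs v) × Chain xs v

  Cycle : List A → Set
  Cycle [] = ⊥
  Cycle (x ∷ xs) = Chain (x ∷ xs) (# x)

module _ {A : Set} {E : A → ℕ → Set} {# : A → ℕ} where

  Chain-++⁺ : ∀ xs {ys v} → Chain E # xs (startOr # ys v) → Chain E # ys v → Chain E # (xs ++ ys) v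
  Chain-++⁺ [] _ q = q
  Chain-++⁺ (x ∷ []) (e , _) q = e , q
  Chain-++⁺ (x ∷ xs@(_ ∷ _)) (e , p) q = e , Chain-++⁺ xs p q

  Chain-++⁻ : ∀ xs {ys v} → Chain E # (xs ++ ys) v → Chain E # xs (startOr # ys v) × Chain E # ys v
  Chain-++⁻ [] q = tt , q
  Chain-++⁻ (x ∷ []) (e , q) = (e , tt) , q
  Chain-++⁻ (x ∷ xs@(_ ∷ _)) (e , q) = let p , q′ = Chain-++⁻ xs q in (e , p) , q′

  Chain⇒Cycle : ∀ xs {x} → Chain E # (xs ++ [ x ]) (startOr # xs (# x)) → Cycle E # (xs ++ [ x ])
  Chain⇒Cycle [] chain = chain
  Chain⇒Cycle (_ ∷ _) chain = chain

  Cycle⇒Chain : ∀ xs u ys → Cycle E # (xs ++ u ∷ ys) → Chain E # (xs ++ u ∷ ys) (startOr # xs (# u))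
  Cycle⇒Chain [] u ys cyc = cyc
  Cycle⇒Chain (_ ∷ _) u ys cyc = cyc

  Cycle-rotate : ∀ xs u ys → Cycle E # (xs ++ u ∷ ys) → Cycle E # (u ∷ ys ++ xs)
  Cycle-rotate xs u ys cyc = let p , q = Chain-++⁻ xs (Cycle⇒Chain xs u ys cyc) in Chain-++⁺ (u ∷ ys) q p

Maps : (ℕ → ℕ) → ℕ → ℕ → Set
Maps π u v = π u ≡ v

iter-suc : ∀ π m u → iter π (suc m) u ≡ iter π m (π u)
iter-suc π zero u = refl
iter-suc π (suc m) u = cong π (iter-suc π m u)

Chain⇒iter : ∀ π u us v {w} → Chain (Maps π) id (u ∷ us) v → w ∈ u ∷ us → ∃ λ m → m < length (u ∷ us) × iter π m u ≡ w
Chain⇒iter π u us v _ (here refl) = 0 , s≤s z≤n , refl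
Chain⇒iter π u (u′ ∷ us) v (refl , chain) (there w∈us) =
  let m , m< , eq = Chain⇒iter π u′ us v chain w∈us in suc m , s≤s m< , trans (iter-suc π m u) eq

Chain-closed : ∀ π us v {w} → Chain (Maps π) id us v → w ∈ us → π w ∈ us ⊎ π w ≡ v
Chain-closed π (u ∷ []) v (eq , _) (here refl) = inj₂ eq
Chain-closed π (u ∷ u′ ∷ us) v (eq , _) (here refl) = inj₁ (there (here eq))
Chain-closed π (u ∷ us) v (_ , chain) (there w∈us) with Chain-closed π us v chain w∈us
... | inj₁ πw∈us = inj₁ (there πw∈us)
... | inj₂ πw≡v = inj₂ πw≡v

Cycle-closed : ∀ π us {w} → Cycle (Maps π) id us → w ∈ us → π w ∈ us
Cycle-closed π (u ∷ us) cyc w∈us with Chain-closed π (u ∷ us) u cyc w∈us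
... | inj₁ πw∈us = πw∈us
... | inj₂ πw≡u = here πw≡u

Cycle⇒iter : ∀ π us {u w} → Cycle (Maps π) id us → u ∈ us → w ∈ us → ∃ λ m → m < length us × iter π m u ≡ w
Cycle⇒iter π us {u} cyc u∈us w∈us with ∈-∃++ u∈us
... | xs , ys , refl =
  let m , m< , eq = Chain⇒iter π u (ys ++ xs) u (Cycle-rotate xs u ys cyc) (∈-resp-↭ (++-comm-↭ xs (u ∷ ys)) w∈us)
  in m , subst (m <_) (sym (↭-length (++-comm-↭ xs (u ∷ ys)))) m< , eq

iter-∈ : ∀ π us m {u} → Cycle (Maps π) id us → u ∈ us → iter π m u ∈ us
iter-∈ π us zero cyc u∈us = u∈us
iter-∈ π us (suc m) cyc u∈us = Cycle-closed π us cyc (iter-∈ π us m cyc u∈us)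

and-map⁻ : ∀ (p : ℕ → Bool) xs {x} → T (and (map p xs)) → x ∈ xs → T (p x)
and-map⁻ p (x ∷ xs) t (here refl) = proj₁ (Equivalence.to (T-∧ {p x}) t)
and-map⁻ p (x ∷ xs) t (there x∈xs) = and-map⁻ p xs (proj₂ (Equivalence.to (T-∧ {p x}) t)) x∈xs

and-map⁺ : ∀ (p : ℕ → Bool) xs → (∀ {x} → x ∈ xs → T (p x)) → T (and (map p xs))
and-map⁺ p [] _ = tt
and-map⁺ p (x ∷ xs) ts = Equivalence.from (T-∧ {p x}) (ts (here refl) , and-map⁺ p xs (ts ∘ there))

isCycleMin⇒≤ : ∀ n π i → isCycleMin n π i ≡ true → ∀ m → m < n → i ≤ iter π m i
isCycleMin⇒≤ n π i eq m m<n = ≤ᵇ⇒≤ i _ (and-map⁻ (λ m → i ≤ᵇ iter π m i) (upTo n) (true⇒T eq) (∈-upTo⁺ m<n))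

≤⇒isCycleMin : ∀ n π i → (∀ m → m < n → i ≤ iter π m i) → isCycleMin n π i ≡ true
≤⇒isCycleMin n π i i≤ = T⇒true (and-map⁺ _ (upTo n) (λ m∈ → ≤⇒≤ᵇ (i≤ _ (∈-upTo⁻ m∈))))

Unique-resp-↭ : ∀ {A : Set} {xs ys : List A} → xs ↭ ys → Unique xs → Unique ys
Unique-resp-↭ {A} p = Permₛ.Unique-resp-↭ (≡.setoid A) (↭⇒↭ₛ p)

count : ∀ {A : Set} → (A → Bool) → List A → ℕ
count p = length ∘ filterᵇ p

count-++ : ∀ {A : Set} (p : A → Bool) xs ys → count p (xs ++ ys) ≡ count p xs + count p ys
count-++ p xs ys = trans (cong length (List.filter-++ _ xs ys)) (List.length-++ (filterᵇ p xs))

count-none : ∀ {A : Set} (p : A → Bool) xs → (∀ {u} → u ∈ xs → p u ≢ true) → count p xs ≡ 0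
count-none p [] _ = refl
count-none p (x ∷ xs) fails with p x in px
... | true = contradiction px (fails (here refl))
... | false = count-none p xs (fails ∘ there)

count-one : ∀ {A : Set} (p : A → Bool) xs {μ} → Unique xs → μ ∈ xs → p μ ≡ true → (∀ {u} → u ∈ xs → p u ≡ true → u ≡ μ) → count p xs ≡ 1
count-one p (x ∷ xs) (x∉ ∷ _) (here refl) pμ only rewrite pμ =
  cong suc (count-none p xs (λ u∈xs pu → All.lookup x∉ u∈xs (sym (only (there u∈xs) pu))))
count-one p (x ∷ xs) (x∉ ∷ xs!) (there μ∈xs) pμ only with p x in px
... | true = contradiction (only (here refl) px) (All.lookup x∉ μ∈xs)
... | false = count-one p xs xs! μ∈xs pμ (only ∘ there)

minimum : ∀ x xs → ∃ λ μ → μ ∈ x ∷ xs × (∀ {u} → u ∈ x ∷ xs → μ ≤ u)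
minimum x [] = x , here refl , λ { (here refl) → ≤-refl }
minimum x (y ∷ xs) with minimum y xs
... | μ , μ∈ , μ≤ with ≤-total x μ
... | inj₁ x≤μ = x , here refl , λ { (here refl) → ≤-refl ; (there u∈) → ≤-trans x≤μ (μ≤ u∈) }
... | inj₂ μ≤x = μ , there μ∈ , λ { (here refl) → μ≤x ; (there u∈) → μ≤ u∈ }

-- From any point of the cycle the minimum is reached in fewer than `length us` steps, and
-- `length us ≤ n` places it among the `n` iterates that `isCycleMin` inspects.
count-cycle : ∀ n π us → Unique us → length us ≤ n → Cycle (Maps π) id us → count (isCycleMin n π) us ≡ 1
count-cycle n π us@(u₀ ∷ us₀) us! us≤n cyc with minimum u₀ us₀
... | μ , μ∈ , μ≤ = count-one (isCycleMin n π) us us! μ∈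
  (≤⇒isCycleMin n π μ (λ m _ → μ≤ (iter-∈ π us m cyc μ∈)))
  (λ {u} u∈ min → let m , m< , eq = Cycle⇒iter π us cyc u∈ μ∈ in
    ≤-antisym (subst (u ≤_) eq (isCycleMin⇒≤ n π u min m (<-≤-trans m< us≤n))) (μ≤ u∈))

Unique-++⁻ : ∀ {A : Set} (xs : List A) {ys} → Unique (xs ++ ys) → Unique xs × Unique ys
Unique-++⁻ [] ys! = [] , ys!
Unique-++⁻ (x ∷ xs) (x∉ ∷ !) = let xs! , ys! = Unique-++⁻ xs ! in All.++⁻ˡ xs x∉ ∷ xs! , ys!

count-cycles : ∀ n π uss → Unique (concat uss) → length (concat uss) ≤ n → All (Cycle (Maps π) id) uss →
  count (isCycleMin n π) (concat uss) ≡ length uss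
count-cycles n π [] _ _ _ = refl
count-cycles n π (us ∷ uss) ! len≤n (cyc ∷ cycs) = let us! , uss! = Unique-++⁻ us ! in
  trans (count-++ (isCycleMin n π) us (concat uss)) (cong₂ _+_
    (count-cycle n π us us! (≤-trans (≤-trans (m≤m+n _ _) (≤-reflexive (sym (List.length-++ us)))) len≤n) cyc)
    (count-cycles n π uss uss! (≤-trans (≤-trans (m≤n+m _ _) (≤-reflexive (sym (List.length-++ us)))) len≤n) cycs))

z-cycles : ∀ n π uss → concat uss ↭ upTo n → All (Cycle (Maps π) id) uss → z n π ≡ length uss
z-cycles n π uss perm cycs = trans (↭-length (filter-↭ (T? ∘ isCycleMin n π) (↭-sym perm)))
  (count-cycles n π uss (Unique-resp-↭ (↭-sym perm) (upTo⁺ n)) (≤-reflexive (trans (↭-length perm) (List.length-upTo n))) cycs)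

-- Faces of a partition and the insertion of a point

at-αP : ∀ s t → t < length s → αP s t < length s × at s (αP s t) ≡ at s t
at-αP s t t<n with αP-cases s t t<n
... | inj₁ next = Next.w<n next , sym (Next.same next)
... | inj₂ (_ , first) = First.w<n first , First.label first

at-iter : ∀ s m t → t < length s → iter (αP s) m t < length s × at s (iter (αP s) m t) ≡ at s t
at-iter s zero t t<n = t<n , refl
at-iter s (suc m) t t<n = let i<n , eq = at-iter s m t t<n ; j<n , eq′ = at-αP s (iter (αP s) m t) i<n in j<n , trans eq′ eq

First⇒≤ : ∀ {s c w u} → First s c w → at s u ≡ c → w ≤ u
First⇒≤ {w = w} {u} first eq with w ≤? u
... | yes w≤u = w≤u
... | no w≰u = contradiction eq (First.before first u (≰⇒> w≰u))

First⇒isCycleMin : ∀ {s c w} → First s c w → isCycleMin (length s) (αP s) w ≡ true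
First⇒isCycleMin {s} {c} {w} first = ≤⇒isCycleMin (length s) (αP s) w
  (λ m _ → First⇒≤ first (trans (proj₂ (at-iter s m w (First.w<n first))) (First.label first)))

-- `f` bounds the distance from `u` to the end of the string; every step inside a block moves to the
-- right and uses some of it.
iter-reaches-First : ∀ s f u → u < length s → length s ≤ u + f → ∃ λ m → m ≤ f × First s (at s u) (iter (αP s) m u)
iter-reaches-First s zero u u<n n≤ = contradiction (subst (length s ≤_) (+-identityʳ u) n≤) (<⇒≱ u<n)
iter-reaches-First s (suc f) u u<n n≤ with αP-cases s u u<n
... | inj₂ (_ , first) = 1 , s≤s z≤n , first
... | inj₁ next =
  let m , m≤f , first = iter-reaches-First s f (αP s u) (Next.w<n next)
        (≤-trans (≤-trans n≤ (≤-reflexive (+-suc u f))) (+-monoˡ-≤ f (Next.t<w next)))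
  in suc m , s≤s m≤f , ≡.subst₂ (First s) (sym (Next.same next)) (sym (iter-suc (αP s) m u)) first

Next⇒¬isCycleMin : ∀ {s t w} → Next s t w → isCycleMin (length s) (αP s) w ≢ true
Next⇒¬isCycleMin {s} {t} {w} next min =
  let m , m≤ , first = iter-reaches-First s (length s ∸ w) w (Next.w<n next) (≤-reflexive (sym (m+[n∸m]≡n (<⇒≤ (Next.w<n next)))))
      w≤ = isCycleMin⇒≤ (length s) (αP s) w min m
             -- `w` is positive because `t < w`, so `length s ∸ w` stays below the number of
             -- iterates inspected.
             (≤-<-trans m≤ (∸-monoʳ-< {length s} {w} {0} (≤-<-trans z≤n (Next.t<w next)) (<⇒≤ (Next.w<n next))))
  in <⇒≱ (Next.t<w next) (≤-trans w≤ (First⇒≤ first (Next.same next)))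

Point : Set
Point = ℕ × Maybe ℕ

labels : List Point → List ℕ
labels = mapMaybe proj₂

HasPredecessor : List ℕ → Point → Set
HasPredecessor s (w , m) = ∃ λ t → Precedes s t m w

-- The labelled points are exactly the cycle minima of `αP s`, so blocks are counted without listing
-- the cycles of `αP s`.
count-isCycleMin : ∀ s pts → All (HasPredecessor s) pts →
  count (isCycleMin (length s) (αP s)) (map proj₁ pts) ≡ length (labels pts)
count-isCycleMin s [] [] = refl
count-isCycleMin s ((w , just c) ∷ pts) ((_ , first , _) ∷ ps) rewrite First⇒isCycleMin first = cong suc (count-isCycleMin s pts ps)
count-isCycleMin s ((w , nothing) ∷ pts) ((_ , next) ∷ ps) with isCycleMin (length s) (αP s) w in eq
... | true = contradiction eq (Next⇒¬isCycleMin next)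
... | false = count-isCycleMin s pts ps

z-αP : ∀ s pts → map proj₁ pts ↭ upTo (length s) → All (HasPredecessor s) pts → z (length s) (αP s) ≡ length (labels pts)
z-αP s pts perm ps = trans (↭-length (filter-↭ (T? ∘ isCycleMin (length s) (αP s)) (↭-sym perm))) (count-isCycleMin s pts ps)

-- Appending a label to a growth string

length-snoc : ∀ {A : Set} (s : List A) c → length (s ++ [ c ]) ≡ suc (length s)
length-snoc s c = trans (List.length-++ s) (+-comm (length s) 1)

at-snoc-< : ∀ s c j → j < length s → at (s ++ [ c ]) j ≡ at s j
at-snoc-< (_ ∷ s) c zero _ = refl
at-snoc-< (_ ∷ s) c (suc j) (s≤s j<n) = at-snoc-< s c j j<n

at-snoc-length : ∀ s c → at (s ++ [ c ]) (length s) ≡ c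
at-snoc-length [] c = refl
at-snoc-length (_ ∷ s) c = at-snoc-length s c

at<nblocks : ∀ s j → j < length s → at s j < nblocks s
at<nblocks (x ∷ s) zero _ = m≤m⊔n (suc x) (nblocks s)
at<nblocks (x ∷ s) (suc j) (s≤s j<n) = ≤-trans (at<nblocks s j j<n) (m≤n⊔m (suc x) (nblocks s))

nblocks-snoc : ∀ s c → nblocks (s ++ [ c ]) ≡ nblocks s ⊔ suc c
nblocks-snoc [] c = refl
nblocks-snoc (x ∷ s) c = trans (cong (suc x ⊔_) (nblocks-snoc s c)) (sym (⊔-assoc (suc x) (nblocks s) (suc c)))

nblocks-snoc-< : ∀ s c → c < nblocks s → nblocks (s ++ [ c ]) ≡ nblocks s
nblocks-snoc-< s c c< = trans (nblocks-snoc s c) (m≥n⇒m⊔n≡m c<)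

nblocks-snoc-new : ∀ s → nblocks (s ++ [ nblocks s ]) ≡ suc (nblocks s)
nblocks-snoc-new s = trans (nblocks-snoc s (nblocks s)) (m≤n⇒m⊔n≡n (n≤1+n _))

module _ (s : List ℕ) (c : ℕ) where

  private
    s⁺ = s ++ [ c ]
    n = length s

  n<length-snoc : n < length s⁺
  n<length-snoc = ≤-reflexive (sym (length-snoc s c))

  Next-snoc : ∀ {t w} → Next s t w → Next s⁺ t w
  Next-snoc {t} {w} (mkNext t<w w<n same between) =
    mkNext t<w (<-trans w<n n<length-snoc) (trans at-t (trans same (sym (at-snoc-< s c w w<n))))
      (λ j t<j j<w eq → between j t<j j<w (trans (sym (at-snoc-< s c j (<-trans j<w w<n))) (trans eq at-t)))
    where at-t = at-snoc-< s c t (<-trans t<w w<n)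

  First-snoc : ∀ {d w} → First s d w → First s⁺ d w
  First-snoc {d} {w} (mkFirst w<n label before) =
    mkFirst (<-trans w<n n<length-snoc) (trans (at-snoc-< s c w w<n) label)
      (λ j j<w eq → before j j<w (trans (sym (at-snoc-< s c j (<-trans j<w w<n))) eq))

  Last-snoc : ∀ {d t} → d ≢ c → Last s d t → Last s⁺ d t
  Last-snoc {d} {t} d≢c (mkLast t<n label after) =
    mkLast (<-trans t<n n<length-snoc) (trans (at-snoc-< s c t t<n) label) after′
    where
    after′ : ∀ j → t < j → j < length s⁺ → at s⁺ j ≢ d
    after′ j t<j j< eq with m≤n⇒m<n∨m≡n (≤-pred (subst (j <_) (length-snoc s c) j<))
    ... | inj₁ j<n = after j t<j j<n (trans (sym (at-snoc-< s c j j<n)) eq)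
    ... | inj₂ refl = d≢c (trans (sym eq) (at-snoc-length s c))

  Last-snoc-new : Last s⁺ c n
  Last-snoc-new = mkLast n<length-snoc (at-snoc-length s c)
    (λ j n<j j< _ → <⇒≱ n<j (≤-pred (subst (j <_) (length-snoc s c) j<)))

  Next-snoc-new : ∀ {t} → Last s c t → Next s⁺ t n
  Next-snoc-new {t} (mkLast t<n label after) = mkNext t<n n<length-snoc (trans at-t (trans label (sym (at-snoc-length s c))))
    (λ j t<j j<n eq → after j t<j j<n (trans (sym (at-snoc-< s c j j<n)) (trans eq (trans at-t label))))
    where at-t = at-snoc-< s c t t<n

  First-snoc-new : c ≡ nblocks s → First s⁺ c n
  First-snoc-new refl = mkFirst n<length-snoc (at-snoc-length s c)
    (λ j j<n eq → <⇒≢ (at<nblocks s j j<n) (trans (sym (at-snoc-< s c j j<n)) eq))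

-- σ = ζ α⁻¹ maps w to t + 1 when α t = w. Writing n for the image 0 of the last point n - 1
-- makes the edges independent of n.
Edge : List ℕ → Point → ℕ → Set
Edge s (w , m) v = ∃ λ t → v ≡ suc t × Precedes s t m w

-- An edge into the interior of a block depends only on earlier points, and the edge at a block
-- minimum depends on the last element of its block. Only the last element of block `c` changes.
Edge-snoc : ∀ s c pt {v} → proj₂ pt ≢ just c → Edge s pt v → Edge (s ++ [ c ]) pt v
Edge-snoc s c (w , nothing) _ (t , eq , next) = t , eq , Next-snoc s c next
Edge-snoc s c (w , just d) d≢c (t , eq , first , last) = t , eq , First-snoc s c first , Last-snoc s c (d≢c ∘ cong just) last

Avoids : ℕ → Point → Set
Avoids c pt = proj₂ pt ≢ just c

Chain-snoc : ∀ s c pts {v} → All (Avoids c) pts → Chain (Edge s) proj₁ pts v → Chain (Edge (s ++ [ c ])) proj₁ pts v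
Chain-snoc s c [] _ _ = tt
Chain-snoc s c (pt ∷ pts) (a ∷ as) (e , es) = Edge-snoc s c pt a e , Chain-snoc s c pts as es

Cycle-snoc : ∀ s c pts → All (Avoids c) pts → Cycle (Edge s) proj₁ pts → Cycle (Edge (s ++ [ c ])) proj₁ pts
Cycle-snoc s c (pt ∷ pts) as cyc = Chain-snoc s c (pt ∷ pts) as cyc

Cycles-snoc : ∀ s c ptss → All (Avoids c) (concat ptss) → All (Cycle (Edge s) proj₁) ptss → All (Cycle (Edge (s ++ [ c ])) proj₁) ptss
Cycles-snoc s c [] _ [] = []
Cycles-snoc s c (pts ∷ ptss) as (cyc ∷ cycs) = Cycle-snoc s c pts (All.++⁻ˡ pts as) cyc ∷ Cycles-snoc s c ptss (All.++⁻ʳ pts as) cycs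

labels-avoid : ∀ c pts → All (c ≢_) (labels pts) → All (Avoids c) pts
labels-avoid c [] _ = []
labels-avoid c ((w , nothing) ∷ pts) as = (λ ()) ∷ labels-avoid c pts as
labels-avoid c ((w , just d) ∷ pts) (c≢d ∷ as) = (λ { refl → c≢d refl }) ∷ labels-avoid c pts as

concat-↭ : ∀ {A : Set} {xss yss : List (List A)} → xss ↭ yss → concat xss ↭ concat yss
concat-↭ _↭_.refl = ↭-refl
concat-↭ (_↭_.prep xs p) = ++⁺ˡ xs (concat-↭ p)
concat-↭ (_↭_.swap xs ys p) = ↭-trans (++⁺ˡ xs (++⁺ˡ ys (concat-↭ p))) (shifts xs ys)
concat-↭ (_↭_.trans p q) = ↭-trans (concat-↭ p) (concat-↭ q)

data StartsAtZero : List Point → Set where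
  starts : ∀ pts → StartsAtZero ((0 , just 0) ∷ pts)

StartsAtZero-++ : ∀ {pts} pts′ → StartsAtZero pts → StartsAtZero (pts ++ pts′)
StartsAtZero-++ pts′ (starts pts) = starts (pts ++ pts′)

StartsAtZero-prefix : ∀ pts pt {pts′} → StartsAtZero (pts ++ pt ∷ pts′) → StartsAtZero (pts ++ [ pt ])
StartsAtZero-prefix [] pt (starts _) = starts []
StartsAtZero-prefix (_ ∷ pts) pt (starts _) = starts (pts ++ [ pt ])

-- The cycle decomposition of σ: outer is the cycle of 0, listed from 0 on.
record Faces (s : List ℕ) (outer : List Point) (others : List (List Point)) : Set where
  field
    points : map proj₁ (outer ++ concat others) ↭ upTo (length s)
    labelled : labels (outer ++ concat others) ↭ upTo (nblocks s)
    start : StartsAtZero outer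
    outer-chain : Chain (Edge s) proj₁ outer (length s)
    other-cycles : All (Cycle (Edge s) proj₁) others

upTo-suc-↭ : ∀ n → n ∷ upTo n ↭ upTo (suc n)
upTo-suc-↭ n = ↭-trans (∷↭∷ʳ n (upTo n)) (↭-reflexive (List.upTo-∷ʳ n))

points-snoc : ∀ (s : List ℕ) (c : ℕ) m {pts pts′ : List Point} → map proj₁ pts ↭ upTo (length s) → pts′ ↭ (length s , m) ∷ pts → map proj₁ pts′ ↭ upTo (length (s ++ [ c ]))
points-snoc s c m points perm = ↭-trans (map⁺ proj₁ perm) (↭-trans (↭-prep _ points)
  (↭-trans (upTo-suc-↭ (length s)) (↭-reflexive (cong upTo (sym (length-snoc s c))))))

labels-join : ∀ s c {w pts pts′} → c < nblocks s → labels pts ↭ upTo (nblocks s) → pts′ ↭ (w , nothing) ∷ pts → labels pts′ ↭ upTo (nblocks (s ++ [ c ]))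
labels-join s c c< labelled perm = ↭-trans (mapMaybe-↭ proj₂ perm)
  (↭-trans labelled (↭-reflexive (cong upTo (sym (nblocks-snoc-< s c c<)))))

-- Labels are distinct, so once the minimum of block `c` is set aside, all remaining edges survive
-- the insertion.
rest-avoids : ∀ {c w pts} n rest → labels pts ↭ upTo n → pts ↭ (w , just c) ∷ rest → c < n × All (Avoids c) rest
rest-avoids {c} n rest labelled perm with ↭-trans (↭-sym (mapMaybe-↭ proj₂ perm)) labelled
... | labelled′ with Unique-resp-↭ (↭-sym labelled′) (upTo⁺ n)
... | c∉ ∷ _ = ∈-upTo⁻ (∈-resp-↭ labelled′ (here refl)) , labels-avoid c rest c∉

module _ {s : List ℕ} where

  open import Algebra.Solver.CommutativeMonoid (++-commutativeMonoid {A = Point}) using (solve; _⊜_) renaming (_⊕_ to _∪_)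

  private n = length s

  -- The singleton is a fixed point, which gives the edge from `n` to n + 1; the outer chain, so far
  -- aimed at `n`, now passes through it.
  faces-new : ∀ {outer others} → Faces s outer others → Faces (s ++ [ nblocks s ]) (outer ++ [ (n , just (nblocks s)) ]) others
  faces-new {outer} {others} F = record
    { points = points-snoc s (nblocks s) (just (nblocks s)) points perm
    ; labelled = ↭-trans (mapMaybe-↭ proj₂ perm) (↭-trans (↭-prep _ labelled) (↭-trans (upTo-suc-↭ (nblocks s))
        (↭-reflexive (cong upTo (sym (nblocks-snoc-new s))))))
    ; start = StartsAtZero-++ _ start
    ; outer-chain = Chain-++⁺ outer (Chain-snoc s (nblocks s) outer (All.++⁻ˡ outer avoids) outer-chain)
        ((n , length-snoc s _ , First-snoc-new s (nblocks s) refl , Last-snoc-new s (nblocks s)) , tt)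
    ; other-cycles = Cycles-snoc s (nblocks s) others (All.++⁻ʳ outer avoids) other-cycles }
    where
    open Faces F
    perm : (outer ++ [ (n , just (nblocks s)) ]) ++ concat others ↭ (n , just (nblocks s)) ∷ (outer ++ concat others)
    perm = solve 3 (λ o x r → (o ∪ x) ∪ r ⊜ x ∪ (o ∪ r)) ↭-refl outer [ (n , just (nblocks s)) ] (concat others)
    avoids : All (Avoids (nblocks s)) (outer ++ concat others)
    avoids = labels-avoid (nblocks s) _ (All.tabulate λ d∈ eq → <⇒≢ (∈-upTo⁻ (∈-resp-↭ labelled d∈)) (sym eq))

  -- Let `t` be the old last element of block `c`. The edge from `a` to t + 1 is replaced by one
  -- from `a` to n + 1 and one from `n` to t + 1. So the outer chain ends after `a`, and the tail
  -- `X`, aimed at `n`, closes up through `n`.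
  faces-split : ∀ {others} P a c X → Faces s (P ++ (a , just c) ∷ X) others →
    c < nblocks s × Faces (s ++ [ c ]) (P ++ [ (a , just c) ]) ((X ++ [ (n , nothing) ]) ∷ others)
  faces-split {others} P a c X F with Chain-++⁻ P (Faces.outer-chain F)
  ... | P-chain , (t , X-start , first , last) , X-chain = c< , record
    { points = points-snoc s c nothing points perm
    ; labelled = labels-join s c c< labelled perm
    ; start = StartsAtZero-prefix P (a , just c) start
    ; outer-chain = Chain-++⁺ P (Chain-snoc s c P (All.++⁻ˡ P avoids) P-chain)
        ((n , length-snoc s c , First-snoc s c first , Last-snoc-new s c) , tt)
    ; other-cycles = X-cycle ∷ Cycles-snoc s c others (All.++⁻ʳ X (All.++⁻ʳ P avoids)) other-cycles }
    where
    open Faces F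
    perm : (P ++ [ (a , just c) ]) ++ (X ++ [ (n , nothing) ]) ++ concat others ↭ (n , nothing) ∷ ((P ++ (a , just c) ∷ X) ++ concat others)
    perm = solve 5 (λ p a x n r → (p ∪ a) ∪ ((x ∪ n) ∪ r) ⊜ n ∪ ((p ∪ (a ∪ x)) ∪ r)) ↭-refl
      P [ (a , just c) ] X [ (n , nothing) ] (concat others)
    fresh : c < nblocks s × All (Avoids c) (P ++ X ++ concat others)
    fresh = rest-avoids (nblocks s) (P ++ X ++ concat others) labelled
      (solve 4 (λ p a x r → (p ∪ (a ∪ x)) ∪ r ⊜ a ∪ (p ∪ (x ∪ r))) ↭-refl P [ (a , just c) ] X (concat others))
    c< = proj₁ fresh
    avoids = proj₂ fresh
    n-edge : Edge (s ++ [ c ]) (n , nothing) (startOr proj₁ X n)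
    n-edge = t , X-start , Next-snoc-new s c last
    X-chain′ : Chain (Edge (s ++ [ c ])) proj₁ (X ++ [ (n , nothing) ]) (startOr proj₁ X n)
    X-chain′ = Chain-++⁺ X (Chain-snoc s c X (All.++⁻ˡ X (All.++⁻ʳ P avoids)) X-chain) (n-edge , tt)
    X-cycle : Cycle (Edge (s ++ [ c ])) proj₁ (X ++ [ (n , nothing) ])
    X-cycle = Chain⇒Cycle X X-chain′

  -- The same two edges, with `a` on another face: the outer chain reaches `n`, enters that face
  -- just behind `a`, runs once around it and ends at `a`.
  faces-merge : ∀ {outer others} P a c X rest → Faces s outer others → others ↭ (P ++ (a , just c) ∷ X) ∷ rest →
    c < nblocks s × Faces (s ++ [ c ]) (outer ++ (n , nothing) ∷ X ++ P ++ [ (a , just c) ]) rest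
  faces-merge {outer} {others} P a c X rest F others↭ with All-resp-↭ others↭ (Faces.other-cycles F)
  ... | cyc ∷ cycs with Chain-++⁻ P (Cycle⇒Chain P (a , just c) X cyc)
  ... | P-chain , (t , X-start , first , last) , X-chain = c< , record
    { points = points-snoc s c nothing points perm
    ; labelled = labels-join s c c< labelled perm
    ; start = StartsAtZero-++ _ start
    ; outer-chain = Chain-++⁺ outer (Chain-snoc s c outer (All.++⁻ˡ outer avoids) outer-chain)
        ((t , trans (startOr-++ X P) X-start , Next-snoc-new s c last) ,
         Chain-++⁺ X (subst (Chain _ _ X) (sym (startOr-snoc P (a , just c) _)) (Chain-snoc s c X (All.++⁻ˡ X (All.++⁻ʳ P (All.++⁻ʳ outer avoids))) X-chain))
        (Chain-++⁺ P (Chain-snoc s c P (All.++⁻ˡ P (All.++⁻ʳ outer avoids)) P-chain)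
        ((n , length-snoc s c , First-snoc s c first , Last-snoc-new s c) , tt)))
    ; other-cycles = Cycles-snoc s c rest (All.++⁻ʳ X (All.++⁻ʳ P (All.++⁻ʳ outer avoids))) cycs }
    where
    open Faces F
    all↭ : outer ++ concat others ↭ outer ++ (P ++ (a , just c) ∷ X) ++ concat rest
    all↭ = ++⁺ˡ outer (concat-↭ others↭)
    startOr-++ : ∀ (X P : List Point) {v} → startOr proj₁ (X ++ P ++ [ (a , just c) ]) v ≡ startOr proj₁ X (startOr proj₁ P a)
    startOr-++ [] P = startOr-snoc P (a , just c) _
    startOr-++ (_ ∷ _) P = refl
    perm : (outer ++ (n , nothing) ∷ X ++ P ++ [ (a , just c) ]) ++ concat rest ↭ (n , nothing) ∷ (outer ++ concat others)
    perm = ↭-trans (solve 6 (λ o n x p a r → (o ∪ (n ∪ (x ∪ (p ∪ a)))) ∪ r ⊜ n ∪ (o ∪ ((p ∪ (a ∪ x)) ∪ r))) ↭-refl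
      outer [ (n , nothing) ] X P [ (a , just c) ] (concat rest)) (↭-prep _ (↭-sym all↭))
    fresh : c < nblocks s × All (Avoids c) (outer ++ P ++ X ++ concat rest)
    fresh = rest-avoids (nblocks s) (outer ++ P ++ X ++ concat rest) labelled (↭-trans all↭
      (solve 5 (λ o p a x r → o ∪ ((p ∪ (a ∪ x)) ∪ r) ⊜ a ∪ (o ∪ (p ∪ (x ∪ r)))) ↭-refl outer P [ (a , just c) ] X (concat rest)))
    c< = proj₁ fresh
    avoids = proj₂ fresh

Chain⇒predecessors : ∀ {s} pts {v} → Chain (Edge s) proj₁ pts v → All (HasPredecessor s) pts
Chain⇒predecessors [] _ = []
Chain⇒predecessors (pt ∷ pts) ((t , _ , prec) , chain) = (t , prec) ∷ Chain⇒predecessors pts chain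

Cycles⇒predecessors : ∀ {s} ptss → All (Cycle (Edge s) proj₁) ptss → All (HasPredecessor s) (concat ptss)
Cycles⇒predecessors [] [] = []
Cycles⇒predecessors ((pt ∷ pts) ∷ ptss) (cyc ∷ cycs) = All.++⁺ (Chain⇒predecessors (pt ∷ pts) cyc) (Cycles⇒predecessors ptss cycs)

Faces⇒z-αP : ∀ {s outer others} → Faces s outer others → z (length s) (αP s) ≡ nblocks s
Faces⇒z-αP {s} {outer} {others} F = trans
  (z-αP s (outer ++ concat others) points (All.++⁺ (Chain⇒predecessors outer outer-chain) (Cycles⇒predecessors others other-cycles)))
  (trans (↭-length labelled) (List.length-upTo (nblocks s)))
  where open Faces F

-- Counting the cycles of α⁻¹ ζ by faces

ζ⁻¹ : ℕ → ℕ → ℕ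
ζ⁻¹ m zero = m
ζ⁻¹ m (suc i) = i

ζ∘ζ⁻¹ : ∀ m w → w < suc m → ζ (suc m) (ζ⁻¹ m w) ≡ w
ζ∘ζ⁻¹ m zero _ with suc m <ᵇ suc m in eq
... | true = contradiction (<ᵇ⇒< (suc m) (suc m) (true⇒T eq)) (<-irrefl refl)
... | false = refl
ζ∘ζ⁻¹ m (suc i) (s≤s i<m) rewrite T⇒true (<⇒<ᵇ i<m) = refl

map-ζ⁻¹-upTo : ∀ m → map (ζ⁻¹ m) (upTo (suc m)) ↭ upTo (suc m)
map-ζ⁻¹-upTo m = ↭-trans (↭-reflexive (cong (m ∷_) (List.map-applyUpTo suc (ζ⁻¹ m) m))) (upTo-suc-↭ m)

-- ζ⁻¹ conjugates σ = ζ α⁻¹ to α⁻¹ ζ.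
module _ {s : List ℕ} {m : ℕ} (n≡ : length s ≡ suc m) where

  private
    β : ℕ → ℕ
    β i = inv (length s) (αP s) (ζ (length s) i)

  Precedes⇒β : ∀ {t w} tag → Precedes s t tag w → w < length s → β (ζ⁻¹ m w) ≡ t
  Precedes⇒β {t} {w} tag prec w<n = trans
    (cong (inv (length s) (αP s)) (trans (cong (λ n → ζ n (ζ⁻¹ m w)) n≡) (ζ∘ζ⁻¹ m w (subst (w <_) n≡ w<n))))
    (inv-unique (length s) (αP s) w t (Precedes⇒< tag prec) (Precedes⇒αP tag prec) (Precedes-unique tag prec))

  Edge⇒β : ∀ pt {v} → Edge s pt v → β (ζ⁻¹ m (proj₁ pt)) ≡ ζ⁻¹ m v
  Edge⇒β (w , nothing) (t , refl , next) = Precedes⇒β nothing next (Next.w<n next)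
  Edge⇒β (w , just c) (t , refl , first , last) = Precedes⇒β (just c) (first , last) (First.w<n first)

  Chain⇒β : ∀ pts {v} → Chain (Edge s) proj₁ pts v → Chain (Maps β) id (map (ζ⁻¹ m) (map proj₁ pts)) (ζ⁻¹ m v)
  Chain⇒β [] _ = tt
  Chain⇒β (pt ∷ []) (e , _) = Edge⇒β pt e , tt
  Chain⇒β (pt ∷ pts@(_ ∷ _)) (e , chain) = Edge⇒β pt e , Chain⇒β pts chain

  Cycle⇒β : ∀ pts → Cycle (Edge s) proj₁ pts → Cycle (Maps β) id (map (ζ⁻¹ m) (map proj₁ pts))
  Cycle⇒β (pt ∷ pts) cyc = Chain⇒β (pt ∷ pts) cyc

  -- `ζ⁻¹ m` sends both 0 and the placeholder m + 1 to `m`, so the open outer chain becomes a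
  -- genuine cycle.
  outer⇒β : ∀ {pts} → StartsAtZero pts → Chain (Edge s) proj₁ pts (length s) → Cycle (Maps β) id (map (ζ⁻¹ m) (map proj₁ pts))
  outer⇒β (starts pts) chain = subst (Chain (Maps β) id _) (cong (ζ⁻¹ m) n≡) (Chain⇒β (_ ∷ pts) chain)

  Faces⇒z-β : ∀ {outer others} → Faces s outer others → z (length s) β ≡ suc (length others)
  Faces⇒z-β {outer} {others} F = trans (z-cycles (length s) β cycles perm (outer⇒β start outer-chain ∷ All.map⁺ (All.map (λ {pts} → Cycle⇒β pts) other-cycles)))
    (cong suc (List.length-map _ others))
    where
    open Faces F
    cycles : List (List ℕ)
    cycles = map (map (ζ⁻¹ m) ∘ map proj₁) (outer ∷ others)
    concat-cycles : concat cycles ≡ map (ζ⁻¹ m) (map proj₁ (concat (outer ∷ others)))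
    concat-cycles = trans (cong concat (List.map-∘ (outer ∷ others)))
      (trans (List.concat-map (map (map proj₁) (outer ∷ others))) (cong (map (ζ⁻¹ m)) (List.concat-map (outer ∷ others))))
    perm : concat cycles ↭ upTo (length s)
    perm = ↭-trans (↭-reflexive concat-cycles) (↭-trans (map⁺ (ζ⁻¹ m) points)
      (subst (λ n → map (ζ⁻¹ m) (upTo n) ↭ upTo n) (sym n≡) (map-ζ⁻¹-upTo m)))

-- Counting by paths

∑[_]_ : ∀ {A : Set} → List A → (A → ℕ) → ℕ
∑[ xs ] f = sum (map f xs)

∑-++ : ∀ {A : Set} (f : A → ℕ) xs ys → ∑[ xs ++ ys ] f ≡ ∑[ xs ] f + ∑[ ys ] f
∑-++ f xs ys = trans (cong sum (List.map-++ f xs ys)) (sum-++ (map f xs) (map f ys))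

∑-↭ : ∀ {A : Set} (f : A → ℕ) {xs ys} → xs ↭ ys → ∑[ xs ] f ≡ ∑[ ys ] f
∑-↭ f p = sum-↭ (map⁺ f p)

∑-map : ∀ {A B : Set} (f : B → ℕ) (g : A → B) xs → ∑[ map g xs ] f ≡ ∑[ xs ] (f ∘ g)
∑-map f g xs = cong sum (sym (List.map-∘ xs))

∑-concatMap : ∀ {A B : Set} (f : B → ℕ) (g : A → List B) xs → ∑[ concatMap g xs ] f ≡ ∑[ xs ] (λ x → ∑[ g x ] f)
∑-concatMap f g [] = refl
∑-concatMap f g (x ∷ xs) = trans (∑-++ f (g x) (concatMap g xs)) (cong (∑[ g x ] f +_) (∑-concatMap f g xs))

-- Multiplication by `y` to the power `b` on coefficient sequences: `k` is the final number of
-- blocks, `b` the number already present.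
shiftBy : ℕ → (ℕ → ℕ) → ℕ → ℕ
shiftBy zero f k = f k
shiftBy (suc b) f zero = 0
shiftBy (suc b) f (suc k) = shiftBy b f k

shiftBy-suc : ∀ b f k → shiftBy (suc b) f k ≡ shiftBy b (shiftBy 1 f) k
shiftBy-suc zero f k = refl
shiftBy-suc (suc b) f zero = refl
shiftBy-suc (suc b) f (suc k) = shiftBy-suc b f k

shiftBy-+ : ∀ b f g k → shiftBy b f k + shiftBy b g k ≡ shiftBy b (λ k → f k + g k) k
shiftBy-+ zero f g k = refl
shiftBy-+ (suc b) f g zero = refl
shiftBy-+ (suc b) f g (suc k) = shiftBy-+ b f g k

shiftBy-* : ∀ b m f k → m * shiftBy b f k ≡ shiftBy b (λ k → m * f k) k
shiftBy-* zero m f k = refl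
shiftBy-* (suc b) m f zero = *-zeroʳ m
shiftBy-* (suc b) m f (suc k) = shiftBy-* b m f k

shiftBy-0 : ∀ b k → 0 ≡ shiftBy b (λ _ → 0) k
shiftBy-0 zero k = refl
shiftBy-0 (suc b) zero = refl
shiftBy-0 (suc b) (suc k) = shiftBy-0 b k

shiftBy-∑ : ∀ {A : Set} b (f : A → ℕ → ℕ) xs k → ∑[ xs ] (λ x → shiftBy b (f x) k) ≡ shiftBy b (λ k → ∑[ xs ] (λ x → f x k)) k
shiftBy-∑ b f [] k = shiftBy-0 b k
shiftBy-∑ b f (x ∷ xs) k = trans (cong (shiftBy b (f x) k +_) (shiftBy-∑ b f xs k)) (shiftBy-+ b (f x) _ k)

∑< : ℕ → (ℕ → ℕ) → ℕ
∑< n f = sum (applyUpTo f n)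

shiftBy-∑< : ∀ b n (f : ℕ → ℕ → ℕ) k → ∑< n (λ j → shiftBy b (f j) k) ≡ shiftBy b (λ k → ∑< n (λ j → f j k)) k
shiftBy-∑< b zero f k = shiftBy-0 b k
shiftBy-∑< b (suc n) f k = trans (cong (shiftBy b (f 0) k +_) (shiftBy-∑< b n (f ∘ suc) k)) (shiftBy-+ b (f 0) _ k)

shiftBy-step : ∀ {A : Set} b (f : ℕ → ℕ) n (g : ℕ → ℕ → ℕ) (xs : List A) (w : A → ℕ) (u : A → ℕ → ℕ) k →
  shiftBy (suc b) f k + (∑< n (λ j → shiftBy b (g j) k) + ∑[ xs ] (λ x → w x * shiftBy b (u x) k))
  ≡ shiftBy b (λ k → shiftBy 1 f k + (∑< n (λ j → g j k) + ∑[ xs ] (λ x → w x * u x k))) k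
shiftBy-step b f n g xs w u k = trans
  (cong₂ _+_ (shiftBy-suc b f k) (trans
    (cong₂ _+_ (shiftBy-∑< b n g k) (trans (cong sum (List.map-cong (λ x → shiftBy-* b (w x) (u x) k) xs)) (shiftBy-∑ b _ xs k)))
    (shiftBy-+ b _ _ k)))
  (shiftBy-+ b _ _ k)

∑<-zero : ∀ n → ∑< n (λ _ → 0) ≡ 0
∑<-zero zero = refl
∑<-zero (suc n) = ∑<-zero n

∑-*-zero : ∀ M → ∑[ M ] (λ m → m * 0) ≡ 0
∑-*-zero [] = refl
∑-*-zero (m ∷ M) = cong₂ _+_ (*-zeroʳ m) (∑-*-zero M)

-- Paths of r further insertions creating k blocks; h + 1 blocks are accessible from the outer face.
-- paths₀: genus 0 so far and M lists the numbers of block minima on the other faces; paths₁: genus 1.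
paths₁ : ℕ → ℕ → ℕ → ℕ
paths₁ zero h zero = 1
paths₁ zero h (suc k) = 0
paths₁ (suc r) h k = shiftBy 1 (paths₁ r (suc h)) k + (∑< (suc h) (λ j → paths₁ r j k) + 0)

paths₀ : ℕ → ℕ → List ℕ → ℕ → ℕ
paths₀ zero h M k = 0
paths₀ (suc r) h M k = shiftBy 1 (paths₀ r (suc h) M) k + (∑< (suc h) (λ j → paths₀ r j (h ∸ j ∷ M) k) + ∑[ M ] (λ m → m * paths₁ r (h + m) k))

# : List Point → ℕ
# = length ∘ labels

#-++ : ∀ xs ys → # (xs ++ ys) ≡ # xs + # ys
#-++ xs ys = trans (cong length (List.mapMaybe-++ proj₂ xs ys)) (List.length-++ (labels xs))

-- Labels occur on a face in no particular order. Since a cut is governed only by the numbers of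
-- minima before and after it, the sum can be reindexed by position.
∑-labels-chain : ∀ (f : ℕ → ℕ) (y : ℕ → ℕ → ℕ) pts →
  (∀ P a c X → pts ≡ P ++ (a , just c) ∷ X → f c ≡ y (# P) (# X)) →
  ∑[ labels pts ] f ≡ ∑< (# pts) (λ j → y j (# pts ∸ suc j))
∑-labels-chain f y [] _ = refl
∑-labels-chain f y ((a , just c) ∷ pts) h = cong₂ _+_ (h [] a c pts refl)
  (∑-labels-chain f (y ∘ suc) pts (λ P a′ c′ X eq → h ((a , just c) ∷ P) a′ c′ X (cong (_ ∷_) eq)))
∑-labels-chain f y ((a , nothing) ∷ pts) h =
  ∑-labels-chain f y pts (λ P a′ c′ X eq → h ((a , nothing) ∷ P) a′ c′ X (cong (_ ∷_) eq))

∑-labels-const : ∀ (f : ℕ → ℕ) u pts → (∀ P a c X → pts ≡ P ++ (a , just c) ∷ X → f c ≡ u) → ∑[ labels pts ] f ≡ # pts * u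
∑-labels-const f u [] _ = refl
∑-labels-const f u ((a , just c) ∷ pts) h = cong₂ _+_ (h [] a c pts refl)
  (∑-labels-const f u pts (λ P a′ c′ X eq → h ((a , just c) ∷ P) a′ c′ X (cong (_ ∷_) eq)))
∑-labels-const f u ((a , nothing) ∷ pts) h =
  ∑-labels-const f u pts (λ P a′ c′ X eq → h ((a , nothing) ∷ P) a′ c′ X (cong (_ ∷_) eq))

∑-labels-cycles : ∀ (f : ℕ → ℕ) (u : ℕ → ℕ) ptss →
  (∀ P a c X → (P ++ (a , just c) ∷ X) ∈ ptss → f c ≡ u (# (P ++ (a , just c) ∷ X))) →
  ∑[ labels (concat ptss) ] f ≡ ∑[ map # ptss ] (λ m → m * u m)
∑-labels-cycles f u [] _ = refl
∑-labels-cycles f u (pts ∷ ptss) h = begin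
  ∑[ labels (pts ++ concat ptss) ] f                        ≡⟨ cong (λ ls → ∑[ ls ] f) (List.mapMaybe-++ proj₂ pts (concat ptss)) ⟩
  ∑[ labels pts ++ labels (concat ptss) ] f                 ≡⟨ ∑-++ f (labels pts) _ ⟩
  ∑[ labels pts ] f + ∑[ labels (concat ptss) ] f           ≡⟨ cong₂ _+_
    (∑-labels-const f (u (# pts)) pts (λ { P a c X refl → h P a c X (here refl) }))
    (∑-labels-cycles f u ptss (λ P a c X ∈ptss → h P a c X (there ∈ptss))) ⟩
  # pts * u (# pts) + ∑[ map # ptss ] (λ m → m * u m)      ∎
  where open ≡-Reasoning

-- Extensions of a growth string, by genus reached

module Counting (N k : ℕ) where

  counted : List ℕ → Bool
  counted s = genusOne N (αP s) ∧ (z N (αP s) ≡ᵇ k)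

  extensions : ℕ → List ℕ → ℕ
  extensions zero s = if counted s then 1 else 0
  extensions (suc r) s = ∑[ upTo (suc (nblocks s)) ] (λ c → extensions r (s ++ [ c ]))

  count-counted : ∀ ss → count counted ss ≡ ∑[ ss ] (extensions 0)
  count-counted [] = refl
  count-counted (s ∷ ss) with counted s
  ... | true = cong suc (count-counted ss)
  ... | false = count-counted ss

  count-rgs : ∀ r n → count counted (rgs (r + n)) ≡ ∑[ rgs n ] (extensions r)
  count-rgs zero n = count-counted (rgs n)
  count-rgs (suc r) n = begin
    count counted (rgs (suc (r + n)))   ≡⟨ cong (count counted ∘ rgs) (sym (+-suc r n)) ⟩
    count counted (rgs (r + suc n))     ≡⟨ count-rgs r (suc n) ⟩
    ∑[ rgs (suc n) ] (extensions r)     ≡⟨ ∑-concatMap (extensions r) _ (rgs n) ⟩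
    ∑[ rgs n ] (λ s → ∑[ map (λ c → s ++ [ c ]) (upTo (suc (nblocks s))) ] (extensions r))
      ≡⟨ cong sum (List.map-cong (λ s → ∑-map (extensions r) (λ c → s ++ [ c ]) (upTo (suc (nblocks s)))) (rgs n)) ⟩
    ∑[ rgs n ] (extensions (suc r)) ∎
    where open ≡-Reasoning

  -- The admissible labels are the new one and, by `Faces.labelled`, those of the block minima, each
  -- of which lies on exactly one face. This sorts the insertions into new blocks, cuts and gluings.
  extensions-step : ∀ r {s outer others h} → Faces s outer others → # outer ≡ suc h → (x : ℕ) (y : ℕ → ℕ → ℕ) (u : ℕ → ℕ) →
    extensions r (s ++ [ nblocks s ]) ≡ x →
    (∀ P a c X → outer ≡ P ++ (a , just c) ∷ X → extensions r (s ++ [ c ]) ≡ y (# P) (# X)) →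
    (∀ P a c X → (P ++ (a , just c) ∷ X) ∈ others → extensions r (s ++ [ c ]) ≡ u (# (P ++ (a , just c) ∷ X))) →
    extensions (suc r) s ≡ x + (∑< (suc h) (λ j → y j (h ∸ j)) + ∑[ map # others ] (λ m → m * u m))
  extensions-step r {s} {outer} {others} {h} F #outer x y u new split merge = begin
    ∑[ upTo (suc (nblocks s)) ] f                            ≡⟨ ∑-↭ f (↭-sym (upTo-suc-↭ (nblocks s))) ⟩
    f (nblocks s) + ∑[ upTo (nblocks s) ] f                  ≡⟨ cong₂ _+_ new (∑-↭ f (↭-sym (Faces.labelled F))) ⟩
    x + ∑[ labels (outer ++ concat others) ] f
      ≡⟨ cong (λ ls → x + ∑[ ls ] f) (List.mapMaybe-++ proj₂ outer (concat others)) ⟩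
    x + ∑[ labels outer ++ labels (concat others) ] f        ≡⟨ cong (x +_) (∑-++ f (labels outer) _) ⟩
    x + (∑[ labels outer ] f + ∑[ labels (concat others) ] f)
      ≡⟨ cong (x +_) (cong₂ _+_ (∑-labels-chain f y outer split) (∑-labels-cycles f u others merge)) ⟩
    x + (∑< (# outer) (λ j → y j (# outer ∸ suc j)) + ∑[ map # others ] (λ m → m * u m))
      ≡⟨ cong (λ o → x + (∑< o (λ j → y j (o ∸ suc j)) + ∑[ map # others ] (λ m → m * u m))) #outer ⟩
    x + (∑< (suc h) (λ j → y j (h ∸ j)) + ∑[ map # others ] (λ m → m * u m)) ∎
    where
    open ≡-Reasoning
    f : ℕ → ℕ
    f c = extensions r (s ++ [ c ])

  -- There are `length others` + 1 faces, so the field `genus` is Euler's relation with one unit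
  -- cancelled. It serves as the definition of `g` along the path.
  record Reached (g r h : ℕ) (s : List ℕ) (outer : List Point) (others : List (List Point)) : Set where
    constructor reached
    field
      faces : Faces s outer others
      #outer : # outer ≡ suc h
      genus : nblocks s + length others + (g + g) ≡ length s
      remaining : r + length s ≡ N

  Faces⇒nonempty : ∀ {s outer others} → Faces s outer others → ∃ λ m → length s ≡ suc m
  Faces⇒nonempty {[]} F with Faces.start F | Faces.outer-chain F
  ... | starts _ | (t , _ , mkFirst () _ _ , last) , _
  Faces⇒nonempty {x ∷ s} F = length s , refl

  remaining-snoc : ∀ r (s : List ℕ) c → suc r + length s ≡ N → r + length (s ++ [ c ]) ≡ N
  remaining-snoc r s c eq = trans (cong (r +_) (length-snoc s c)) (trans (+-suc r (length s)) eq)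

  module _ {g r h : ℕ} {s : List ℕ} where

    reached-new : ∀ {outer others} → Reached g (suc r) h s outer others →
      Reached g r (suc h) (s ++ [ nblocks s ]) (outer ++ [ (length s , just (nblocks s)) ]) others
    reached-new {outer} {others} (reached faces #outer genus remaining) = reached (faces-new faces)
      (trans (#-++ outer _) (trans (+-comm _ 1) (cong suc #outer)))
      (trans (cong (λ b → b + length others + (g + g)) (nblocks-snoc-new s)) (trans (cong suc genus) (sym (length-snoc s _))))
      (remaining-snoc r s _ remaining)

    reached-split : ∀ {others} P a c X → Reached g (suc r) h s (P ++ (a , just c) ∷ X) others →
      c < nblocks s × Reached g r (# P) (s ++ [ c ]) (P ++ [ (a , just c) ]) ((X ++ [ (length s , nothing) ]) ∷ others)
    reached-split {others} P a c X (reached faces #outer genus remaining) = let c< , faces′ = faces-split P a c X faces in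
      c< , reached faces′ (trans (#-++ P _) (+-comm _ 1))
        (trans (cong (λ b → b + suc (length others) + (g + g)) (nblocks-snoc-< s c c<))
          (trans (cong (_+ (g + g)) (+-suc (nblocks s) (length others))) (trans (cong suc genus) (sym (length-snoc s c)))))
        (remaining-snoc r s c remaining)

    reached-merge : ∀ {outer others} P a c X rest → Reached g (suc r) h s outer others → others ↭ (P ++ (a , just c) ∷ X) ∷ rest →
      c < nblocks s × Reached (suc g) r (h + # (P ++ (a , just c) ∷ X)) (s ++ [ c ])
        (outer ++ (length s , nothing) ∷ X ++ P ++ [ (a , just c) ]) rest
    reached-merge {outer} {others} P a c X rest (reached faces #outer genus remaining) others↭ =
      let c< , faces′ = faces-merge P a c X rest faces others↭ in
      c< , reached faces′ labels-merged
        (trans (cong (λ b → b + length rest + (suc g + suc g)) (nblocks-snoc-< s c c<))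
          (trans (solve 3 (λ b l g → b :+ l :+ (con 1 :+ g :+ (con 1 :+ g)) := con 1 :+ (b :+ (con 1 :+ l) :+ (g :+ g))) refl (nblocks s) (length rest) g)
            (trans (cong (λ l → suc (nblocks s + l + (g + g))) (sym (↭-length others↭)))
              (trans (cong suc genus) (sym (length-snoc s c))))))
        (remaining-snoc r s c remaining)
      where
      open +-*-Solver
      labels-merged : # (outer ++ (length s , nothing) ∷ X ++ P ++ [ (a , just c) ]) ≡ suc (h + # (P ++ (a , just c) ∷ X))
      labels-merged = begin
        # (outer ++ (length s , nothing) ∷ X ++ P ++ [ (a , just c) ])  ≡⟨ #-++ outer _ ⟩
        # outer + # (X ++ P ++ [ (a , just c) ])                        ≡⟨ cong₂ _+_ #outer (trans (#-++ X _) (cong (# X +_) (#-++ P _))) ⟩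
        suc h + (# X + (# P + 1))                                       ≡⟨ solve 3 (λ h x p →
          con 1 :+ h :+ (x :+ (p :+ con 1)) := con 1 :+ (h :+ (p :+ (con 1 :+ x)))) refl h (# X) (# P) ⟩
        suc (h + (# P + suc (# X)))                                     ≡⟨ cong (λ e → suc (h + e)) (sym (#-++ P _)) ⟩
        suc (h + # (P ++ (a , just c) ∷ X))                             ∎
        where open ≡-Reasoning

  ∈⇒↭ : ∀ {pts : List Point} {ptss} → pts ∈ ptss → ∃ λ rest → ptss ↭ pts ∷ rest
  ∈⇒↭ {pts} pts∈ with ∈-∃++ pts∈
  ... | ptss₁ , ptss₂ , refl = ptss₁ ++ ptss₂ , shift pts ptss₁ ptss₂

  module _ {g h : ℕ} {s : List ℕ} {outer : List Point} {others : List (List Point)} where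

    -- Cancelling blocks and other faces in the genus condition leaves 3 = 2 g + 1.
    genusOne-reached : Reached g 0 h s outer others → genusOne N (αP s) ≡ (3 ≡ᵇ g + g + 1)
    genusOne-reached (reached faces _ genus refl) with Faces⇒nonempty faces
    ... | m , n≡ = trans
      (cong₂ (λ a b → a + b + 2 ≡ᵇ length s + 1) (Faces⇒z-αP faces) (Faces⇒z-β n≡ faces))
      (trans (cong₂ _≡ᵇ_
        (solve 2 (λ b l → b :+ (con 1 :+ l) :+ con 2 := (b :+ l) :+ con 3) refl (nblocks s) (length others))
        (trans (cong (_+ 1) (sym genus)) (+-assoc (nblocks s + length others) (g + g) 1)))
        (≡ᵇ-cancelˡ (nblocks s + length others)))
      where
      open +-*-Solver
      ≡ᵇ-cancelˡ : ∀ k {a b} → (k + a ≡ᵇ k + b) ≡ (a ≡ᵇ b)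
      ≡ᵇ-cancelˡ zero = refl
      ≡ᵇ-cancelˡ (suc k) = ≡ᵇ-cancelˡ k

    counted-reached : Reached g 0 h s outer others → counted s ≡ (3 ≡ᵇ g + g + 1) ∧ (nblocks s ≡ᵇ k)
    counted-reached R@(reached faces _ _ refl) = cong₂ _∧_ (genusOne-reached R) (cong (_≡ᵇ k) (Faces⇒z-αP faces))

  -- No insertion lowers the genus. This is why `paths₁` offers no gluing and keeps no list of
  -- faces.
  extensions-genus≥2 : ∀ r {g h s outer others} → Reached (2 + g) r h s outer others → extensions r s ≡ 0
  extensions-genus≥2 zero {g} R rewrite counted-reached R | +-suc g (suc g) | +-suc g g = refl
  extensions-genus≥2 (suc r) {g} {h} {s} {outer} {others} R = trans
    (extensions-step r (Reached.faces R) (Reached.#outer R) 0 (λ _ _ → 0) (λ _ → 0)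
      (extensions-genus≥2 r (reached-new R))
      (λ { P a c X refl → extensions-genus≥2 r (proj₂ (reached-split P a c X R)) })
      (λ P a c X C∈ → let rest , others↭ = ∈⇒↭ C∈ in extensions-genus≥2 r (proj₂ (reached-merge P a c X rest R others↭))))
    (cong₂ _+_ (∑<-zero h) (∑-*-zero (map # others)))

  shiftBy-paths₁-zero : ∀ b h → (if b ≡ᵇ k then 1 else 0) ≡ shiftBy b (paths₁ 0 h) k
  shiftBy-paths₁-zero b h = go b k
    where
    go : ∀ b k → (if b ≡ᵇ k then 1 else 0) ≡ shiftBy b (paths₁ 0 h) k
    go zero zero = refl
    go zero (suc k) = refl
    go (suc b) zero = refl
    go (suc b) (suc k) = go b k

  extensions-genus1 : ∀ r {h s outer others} → Reached 1 r h s outer others → extensions r s ≡ shiftBy (nblocks s) (paths₁ r h) k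
  extensions-genus1 zero {h} {s} R rewrite counted-reached R = shiftBy-paths₁-zero (nblocks s) h
  extensions-genus1 (suc r) {h} {s} {outer} {others} R = trans
    (extensions-step r (Reached.faces R) (Reached.#outer R) (shiftBy (suc b) (paths₁ r (suc h)) k) (λ j _ → shiftBy b (paths₁ r j) k)
      (λ m → 0)
      (trans (extensions-genus1 r (reached-new R)) (cong (λ b → shiftBy b (paths₁ r (suc h)) k) (nblocks-snoc-new s)))
      (λ { P a c X refl → let c< , R′ = reached-split P a c X R in
        trans (extensions-genus1 r R′) (cong (λ b → shiftBy b (paths₁ r (# P)) k) (nblocks-snoc-< s c c<)) })
      (λ P a c X C∈ → let rest , others↭ = ∈⇒↭ C∈ in extensions-genus≥2 r (proj₂ (reached-merge P a c X rest R others↭))))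
    (trans (cong (λ e → shiftBy (suc b) (paths₁ r (suc h)) k + (∑< (suc h) (λ j → shiftBy b (paths₁ r j) k) + e)) (∑-*-zero (map # others)))
      (shiftBy-step b (paths₁ r (suc h)) (suc h) (paths₁ r) [] id (λ _ _ → 0) k))
    where b = nblocks s

  extensions-genus0 : ∀ r {h s outer others} → Reached 0 r h s outer others → extensions r s ≡ shiftBy (nblocks s) (paths₀ r h (map # others)) k
  extensions-genus0 zero {h} {s} R rewrite counted-reached R = shiftBy-0 (nblocks s) k
  extensions-genus0 (suc r) {h} {s} {outer} {others} R = trans
    (extensions-step r (Reached.faces R) (Reached.#outer R) (shiftBy (suc b) (paths₀ r (suc h) M) k) (λ j i → shiftBy b (paths₀ r j (i ∷ M)) k)
      (λ m → shiftBy b (paths₁ r (h + m)) k)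
      (trans (extensions-genus0 r (reached-new R)) (cong (λ b → shiftBy b (paths₀ r (suc h) M) k) (nblocks-snoc-new s)))
      (λ { P a c X refl → let c< , R′ = reached-split P a c X R in
        trans (extensions-genus0 r R′) (cong₂ (λ b i → shiftBy b (paths₀ r (# P) (i ∷ M)) k) (nblocks-snoc-< s c c<)
          (trans (#-++ X _) (+-identityʳ (# X)))) })
      (λ P a c X C∈ → let rest , others↭ = ∈⇒↭ C∈ ; c< , R′ = reached-merge P a c X rest R others↭ in
        trans (extensions-genus1 r R′) (cong (λ b → shiftBy b (paths₁ r (h + # (P ++ (a , just c) ∷ X))) k) (nblocks-snoc-< s c c<))))
    (shiftBy-step b (paths₀ r (suc h) M) (suc h) (λ j → paths₀ r j (h ∸ j ∷ M)) M id (λ m → paths₁ r (h + m)) k)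
    where
    b = nblocks s
    M = map # others

faces-initial : Faces [ 0 ] [ (0 , just 0) ] []
faces-initial = record
  { points = ↭-refl ; labelled = ↭-refl ; start = starts []
  ; outer-chain = (0 , refl , mkFirst (s≤s z≤n) refl (λ j ()) ,
      mkLast (s≤s z≤n) refl (λ { zero () ; (suc j) _ (s≤s ()) })) , tt
  ; other-cycles = [] }

p₀≡paths₀ : ∀ r k → p₀ (suc r) k ≡ shiftBy 1 (paths₀ r 0 []) k
p₀≡paths₀ r k = begin
  count counted (rgs (suc r))       ≡⟨ cong (count counted ∘ rgs) (+-comm 1 r) ⟩
  count counted (rgs (r + 1))       ≡⟨ count-rgs r 1 ⟩
  extensions r [ 0 ] + 0            ≡⟨ +-identityʳ _ ⟩
  extensions r [ 0 ]                ≡⟨ extensions-genus0 r (reached faces-initial refl refl (+-comm r 1)) ⟩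
  shiftBy 1 (paths₀ r 0 []) k       ∎
  where
  open Counting (suc r) k
  open ≡-Reasoning

open import Data.Integer as ℤ using (ℤ; +_)
import Data.Integer.Properties as ℤ

-- Generating functions

module ℤ[[y]] = PowerSeries ℤ.+-*-commutativeRing
module ℤ[[y]][[x]] = PowerSeries ℤ[[y]].seriesRing
module K = KernelSeries ℤ[[y]].seriesRing ℤ[[y]].𝑥

open CommutativeRing ℤ[[y]][[x]].seriesRing using (_≈_; 1#)
  renaming (_+_ to _+ₛ_; _*_ to _*ₛ_; _-_ to _-ₛ_; *-cong to *ₛ-cong; refl to ≈-refl; sym to ≈-sym; trans to ≈-trans)
open ℤ[[y]][[x]] using (𝑥)
open KernelSolution.Solution ℤ[[y]][[x]].seriesRing 𝑥 K.y K.c K.T K.c-eq K.T-eq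
  using (T⁵; T⁵-discriminant; discriminant; xyA₀≈x⁴y²T⁵; W; W-rec; U; U-rec; jumps; A; ν)
open FiniteSum ℤ[[y]][[x]].seriesRing using () renaming (∑ to ∑ₛ)
open FiniteSum ℤ.+-*-commutativeRing using () renaming (∑ to ∑ℤ)

𝑦 : FPS
𝑦 = K.y

x*-zero : ∀ f k → (𝑥 *ₛ f) 0 k ≡ + 0
x*-zero f k = ℤ[[y]][[x]].𝑥-*ₚ-zero f k

x*-suc : ∀ f n k → (𝑥 *ₛ f) (suc n) k ≡ f n k
x*-suc f n k = ℤ[[y]][[x]].𝑥-*ₚ-suc f n k

y*-zero : ∀ f n → (𝑦 *ₛ f) n 0 ≡ + 0
y*-zero f n = trans (ℤ[[y]][[x]].const-*ₚ ℤ[[y]].𝑥 f n 0) (ℤ[[y]].𝑥-*ₚ-zero (f n))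

y*-suc : ∀ f n k → (𝑦 *ₛ f) n (suc k) ≡ f n k
y*-suc f n k = trans (ℤ[[y]][[x]].const-*ₚ ℤ[[y]].𝑥 f n (suc k)) (ℤ[[y]].𝑥-*ₚ-suc (f n) k)

coeff-∑ : ∀ h f n k → ∑ₛ h f n k ≡ ∑ℤ h (λ j → f j n k)
coeff-∑ zero f n k = refl
coeff-∑ (suc h) f n k = cong (ℤ._+ f (suc h) n k) (coeff-∑ h f n k)

coeff-ν : ∀ m f n k → (ν m *ₛ f) n k ≡ + m ℤ.* f n k
coeff-ν zero f n k = ℤ[[y]][[x]].*ₚ-zeroˡ f n k
coeff-ν (suc m) f n k = begin
  ((ν m +ₛ 1#) *ₛ f) n k                     ≡⟨ ℤ[[y]][[x]].*ₚ-distribʳ f (ν m) 1# n k ⟩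
  (ν m *ₛ f) n k ℤ.+ (1# *ₛ f) n k           ≡⟨ cong₂ ℤ._+_ (coeff-ν m f n k) (ℤ[[y]][[x]].*ₚ-identityˡ f n k) ⟩
  + m ℤ.* f n k ℤ.+ f n k                  ≡⟨ ℤ.+-comm (+ m ℤ.* f n k) (f n k) ⟩
  f n k ℤ.+ + m ℤ.* f n k                  ≡⟨ sym (ℤ.suc-* (+ m) (f n k)) ⟩
  + suc m ℤ.* f n k                        ∎
  where open ≡-Reasoning

∑<-ℤ : ∀ h f g → (∀ j → + f j ≡ g j) → + ∑< (suc h) f ≡ ∑ℤ h g
∑<-ℤ zero f g f≡g = trans (cong +_ (ℕ.+-identityʳ (f 0))) (f≡g 0)
∑<-ℤ (suc h) f g f≡g = begin
  + ∑< (suc (suc h)) f                 ≡⟨ cong (+_ ∘ sum) (sym (List.applyUpTo-∷ʳ f (suc h))) ⟩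
  + sum (applyUpTo f (suc h) ++ (f (suc h) ∷ []))  ≡⟨ cong +_ (sum-++ (applyUpTo f (suc h)) _) ⟩
  + (∑< (suc h) f ℕ.+ (f (suc h) ℕ.+ 0)) ≡⟨ cong (λ e → + (∑< (suc h) f ℕ.+ e)) (ℕ.+-identityʳ (f (suc h))) ⟩
  + ∑< (suc h) f ℤ.+ + f (suc h)       ≡⟨ cong₂ ℤ._+_ (∑<-ℤ h f g f≡g) (f≡g (suc h)) ⟩
  ∑ℤ (suc h) g                         ∎
  where open ≡-Reasoning

coeff-shift : ∀ f g n → (∀ k → + f k ≡ g n k) → ∀ k → + shiftBy 1 f k ≡ (𝑦 *ₛ g) n k
coeff-shift f g n f≡g zero = sym (y*-zero g n)
coeff-shift f g n f≡g (suc k) = trans (f≡g k) (sym (y*-suc g n k))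

-- Induction on `r`: the factor `𝑥` in `W-rec` expresses coefficient r + 1 at one height through
-- coefficient r at all heights involved.
paths₁≡W : ∀ r h k → + paths₁ r h k ≡ W h r k
paths₁≡W zero h k = sym (trans (W-rec h 0 k) (trans (cong (ℤ._+_ (1# 0 k)) (x*-zero (𝑦 *ₛ W (suc h) +ₛ ∑ₛ h W) k)) (at-zero k)))
  where
  at-zero : ∀ k → 1# 0 k ℤ.+ + 0 ≡ + paths₁ 0 h k
  at-zero zero = refl
  at-zero (suc k) = refl
paths₁≡W (suc r) h k = begin
  + (shiftBy 1 (paths₁ r (suc h)) k ℕ.+ (∑< (suc h) (λ j → paths₁ r j k) ℕ.+ 0))
    ≡⟨ cong (λ e → + (shiftBy 1 (paths₁ r (suc h)) k ℕ.+ e)) (ℕ.+-identityʳ _) ⟩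
  + shiftBy 1 (paths₁ r (suc h)) k ℤ.+ + ∑< (suc h) (λ j → paths₁ r j k)
    ≡⟨ cong₂ ℤ._+_ (coeff-shift _ (W (suc h)) r (paths₁≡W r (suc h)) k)
         (trans (∑<-ℤ h _ _ (λ j → paths₁≡W r j k)) (sym (coeff-∑ h W r k))) ⟩
  (𝑦 *ₛ W (suc h) +ₛ ∑ₛ h W) r k                          ≡⟨ sym (x*-suc _ r k) ⟩
  (𝑥 *ₛ (𝑦 *ₛ W (suc h) +ₛ ∑ₛ h W)) (suc r) k              ≡⟨ sym (ℤ.+-identityˡ _) ⟩
  (1# +ₛ 𝑥 *ₛ (𝑦 *ₛ W (suc h) +ₛ ∑ₛ h W)) (suc r) k         ≡⟨ sym (W-rec h (suc r) k) ⟩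
  W h (suc r) k                                           ∎
  where open ≡-Reasoning

coeff-jumps : ∀ r h M k → + (∑[ M ] (λ m → m ℕ.* paths₁ r (h ℕ.+ m) k)) ≡ jumps h M r k
coeff-jumps r h [] k = refl
coeff-jumps r h (m ∷ M) k = cong₂ ℤ._+_
  (trans (ℤ.pos-* m _) (trans (cong (ℤ._*_ (+ m)) (paths₁≡W r (h ℕ.+ m) k)) (sym (coeff-ν m (W (h ℕ.+ m)) r k))))
  (coeff-jumps r h M k)

paths₀≡U : ∀ r h M k → + paths₀ r h M k ≡ U h M r k
paths₀≡U zero h M k = sym (trans (U-rec h M 0 k) (x*-zero (𝑦 *ₛ U (suc h) M +ₛ (∑ₛ h (λ j → U j (h ∸ j ∷ M)) +ₛ jumps h M)) k))
paths₀≡U (suc r) h M k = begin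
  + shiftBy 1 (paths₀ r (suc h) M) k ℤ.+ (+ ∑< (suc h) (λ j → paths₀ r j (h ∸ j ∷ M) k) ℤ.+ + (∑[ M ] (λ m → m ℕ.* paths₁ r (h ℕ.+ m) k)))
    ≡⟨ cong₂ ℤ._+_ (coeff-shift _ (U (suc h) M) r (paths₀≡U r (suc h) M) k) (cong₂ ℤ._+_
         (trans (∑<-ℤ h _ _ (λ j → paths₀≡U r j (h ∸ j ∷ M) k)) (sym (coeff-∑ h (λ j → U j (h ∸ j ∷ M)) r k)))
         (coeff-jumps r h M k)) ⟩
  (𝑦 *ₛ U (suc h) M +ₛ (∑ₛ h (λ j → U j (h ∸ j ∷ M)) +ₛ jumps h M)) r k    ≡⟨ sym (x*-suc _ r k) ⟩
  (𝑥 *ₛ (𝑦 *ₛ U (suc h) M +ₛ (∑ₛ h (λ j → U j (h ∸ j ∷ M)) +ₛ jumps h M))) (suc r) k ≡⟨ sym (U-rec h M (suc r) k) ⟩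
  U h M (suc r) k ∎
  where open ≡-Reasoning

p₀≡coefficient : ∀ r k → + p₀ (suc r) k ≡ (𝑥 *ₛ (𝑦 *ₛ A 0)) (suc r) k
p₀≡coefficient r k = trans (cong +_ (p₀≡paths₀ r k))
  (trans (coeff-shift _ (A 0) r (paths₀≡U r 0 []) k) (sym (x*-suc _ r k)))

-- Comparison with the series of the statement

x⁴y² : FPS → FPS
x⁴y² f = 𝑥 *ₛ (𝑥 *ₛ (𝑥 *ₛ (𝑥 *ₛ (𝑦 *ₛ (𝑦 *ₛ f)))))

VanishesBelow : ℕ → FPS → Set
VanishesBelow m f = ∀ n k → n < m → f n k ≡ + 0

x*-vanishes : ∀ {m} f → VanishesBelow m f → VanishesBelow (suc m) (𝑥 *ₛ f)
x*-vanishes f _ zero k _ = x*-zero f k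
x*-vanishes f vanishes (suc n) k (s≤s n<m) = trans (x*-suc f n k) (vanishes n k n<m)

x⁴*-vanishes : ∀ f → VanishesBelow 4 (𝑥 *ₛ (𝑥 *ₛ (𝑥 *ₛ (𝑥 *ₛ f))))
x⁴*-vanishes f = x*-vanishes (𝑥 *ₛ (𝑥 *ₛ (𝑥 *ₛ f))) (x*-vanishes (𝑥 *ₛ (𝑥 *ₛ f)) (x*-vanishes (𝑥 *ₛ f) (x*-vanishes f λ _ _ ())))

x*-column : ∀ k f → (∀ n → f n k ≡ + 0) → ∀ n → (𝑥 *ₛ f) n k ≡ + 0
x*-column k f column zero = x*-zero f k
x*-column k f column (suc n) = trans (x*-suc f n k) (column n)

x⁴*-column : ∀ k f → (∀ n → f n k ≡ + 0) → ∀ n → (𝑥 *ₛ (𝑥 *ₛ (𝑥 *ₛ (𝑥 *ₛ f)))) n k ≡ + 0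
x⁴*-column k f column = x*-column k (𝑥 *ₛ (𝑥 *ₛ (𝑥 *ₛ f))) (x*-column k (𝑥 *ₛ (𝑥 *ₛ f)) (x*-column k (𝑥 *ₛ f) (x*-column k f column)))

-- `P₀` is truncated by definition, so the closed form has to vanish for n < 4 and for k < 2.
P₀-characterised : ∀ f → VanishesBelow 4 f → (∀ n → f n 0 ≡ + 0) → (∀ n → f n 1 ≡ + 0) →
  (∀ r k → + p₀ (suc r) k ≡ f (suc r) k) → ∀ n k → P₀ n k ≡ f n k
P₀-characterised f below _ _ _ 0 k = sym (below 0 k (s≤s z≤n))
P₀-characterised f below _ _ _ 1 k = sym (below 1 k (s≤s (s≤s z≤n)))
P₀-characterised f below _ _ _ 2 k = sym (below 2 k (s≤s (s≤s (s≤s z≤n))))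
P₀-characterised f below _ _ _ 3 k = sym (below 3 k (s≤s (s≤s (s≤s (s≤s z≤n)))))
P₀-characterised f _ column₀ _ _ n@(suc (suc (suc (suc _)))) 0 = sym (column₀ n)
P₀-characterised f _ _ column₁ _ n@(suc (suc (suc (suc _)))) 1 = sym (column₁ n)
P₀-characterised f _ _ _ coeff (suc (suc (suc (suc r)))) k@(suc (suc _)) = coeff (suc (suc (suc r))) k

P₀≈x⁴y²T⁵ : P₀ ≈ x⁴y² T⁵
P₀≈x⁴y²T⁵ = P₀-characterised (x⁴y² T⁵) (x⁴*-vanishes (𝑦 *ₛ (𝑦 *ₛ T⁵)))
  (x⁴*-column 0 (𝑦 *ₛ (𝑦 *ₛ T⁵)) (y*-zero (𝑦 *ₛ T⁵)))
  (x⁴*-column 1 (𝑦 *ₛ (𝑦 *ₛ T⁵)) (λ n → trans (y*-suc (𝑦 *ₛ T⁵) n 0) (y*-zero T⁵ n)))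
  (λ r k → trans (p₀≡coefficient r k) (xyA₀≈x⁴y²T⁵ (suc r) k))

sumTo≡∑ℤ : ∀ n {f g} → (∀ i → f i ≡ g i) → sumTo n f ≡ ∑ℤ n g
sumTo≡∑ℤ zero f≡g = f≡g 0
sumTo≡∑ℤ (suc n) f≡g = cong₂ ℤ._+_ (sumTo≡∑ℤ n f≡g) (f≡g (suc n))

coeff-∑ᵧ : ∀ n f k → FiniteSum.∑ ℤ[[y]].seriesRing n f k ≡ ∑ℤ n (λ i → f i k)
coeff-∑ᵧ zero f k = refl
coeff-∑ᵧ (suc n) f k = cong (ℤ._+ f (suc n) k) (coeff-∑ᵧ n f k)

⊛≈* : ∀ f g → f ⊛ g ≈ f *ₛ g
⊛≈* f g n k = begin
  (f ⊛ g) n k                                                    ≡⟨ sumTo≡∑ℤ n (λ i → sumTo≡∑ℤ k (λ j → refl)) ⟩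
  ∑ℤ n (λ i → ∑ℤ k (λ j → f i j ℤ.* g (n ∸ i) (k ∸ j)))
    ≡⟨ sumTo-cong n (λ i → sym (Convolution.*ₚ-∑ ℤ.+-*-commutativeRing (f i) (g (n ∸ i)) k)) ⟩
  ∑ℤ n (λ i → ℤ[[y]]._*ₚ_ (f i) (g (n ∸ i)) k)                   ≡⟨ sym (coeff-∑ᵧ n _ k) ⟩
  FiniteSum.∑ ℤ[[y]].seriesRing n (λ i → ℤ[[y]]._*ₚ_ (f i) (g (n ∸ i))) k
    ≡⟨ sym (Convolution.*ₚ-∑ ℤ[[y]].seriesRing f g n k) ⟩
  (f *ₛ g) n k ∎
  where
  open ≡-Reasoning
  sumTo-cong : ∀ n {f g : ℕ → ℤ} → (∀ i → f i ≡ g i) → ∑ℤ n f ≡ ∑ℤ n g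
  sumTo-cong n f≡g = FiniteSum.∑-cong ℤ.+-*-commutativeRing n (λ i _ → f≡g i)

infixl 7 _⊛-cong_
_⊛-cong_ : ∀ {f f′ g g′} → f ≈ f′ → g ≈ g′ → f ⊛ g ≈ f′ *ₛ g′
_⊛-cong_ {f} {f′} {g} {g′} f≈ g≈ = ≈-trans (⊛≈* f g) (*ₛ-cong {f} {f′} {g} {g′} f≈ g≈)

1≈ : 1ₛ ≈ 1#
1≈ zero zero = refl
1≈ zero (suc k) = refl
1≈ (suc n) k = refl

X≈ : X ≈ 𝑥
X≈ zero k = refl
X≈ (suc zero) zero = refl
X≈ (suc zero) (suc k) = refl
X≈ (suc (suc n)) k = refl

Y≈ : Y ≈ 𝑦
Y≈ zero zero = refl
Y≈ zero (suc zero) = refl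
Y≈ zero (suc (suc k)) = refl
Y≈ (suc n) k = refl

2*≡ : ∀ i → + 2 ℤ.* i ≡ i ℤ.+ i
2*≡ i = trans (ℤ.suc-* (+ 1) i) (cong (ℤ._+_ i) (ℤ.*-identityˡ i))

D≈ : D ≈ discriminant
D≈ n k = cong₂ ℤ._+_
  (cong₂ ℤ._-_ (1≈ n k) (trans (2*≡ _) (cong₂ ℤ._+_ (1+Y*X n k) (1+Y*X n k))))
  (((X≈ ⊛-cong X≈) ⊛-cong (1-Y ⊛-cong 1-Y)) n k)
  where
  1+Y : 1ₛ ⊕ Y ≈ 1# +ₛ 𝑦
  1+Y n k = cong₂ ℤ._+_ (1≈ n k) (Y≈ n k)
  1+Y*X : (1ₛ ⊕ Y) ⊛ X ≈ (1# +ₛ 𝑦) *ₛ 𝑥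
  1+Y*X = 1+Y ⊛-cong X≈
  1-Y : 1ₛ ⊖ Y ≈ 1# -ₛ 𝑦
  1-Y n k = cong₂ ℤ._-_ (1≈ n k) (Y≈ n k)

theorem6p1 : ∃ λ (R : FPS) → IsPow-5/2 D R × (∀ n k → P₀ n k ≡ (X ⊛ X ⊛ X ⊛ X ⊛ Y ⊛ Y ⊛ R) n k)
theorem6p1 = T⁵
  -- `refl` evaluates the constant coefficient of `T⁵`; the other condition is the fifth power of
  -- `T² D = 1`.
  , (refl , ≈-trans (R≈ ⊛-cong R≈ ⊛-cong D≈ ⊛-cong D≈ ⊛-cong D≈ ⊛-cong D≈ ⊛-cong D≈) (≈-trans T⁵-discriminant (≈-sym 1≈)))
  , ≈-trans P₀≈x⁴y²T⁵ (≈-sym (≈-trans (X≈ ⊛-cong X≈ ⊛-cong X≈ ⊛-cong X≈ ⊛-cong Y≈ ⊛-cong Y≈ ⊛-cong R≈) (≈-sym reassociate)))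
  where
  R≈ : T⁵ ≈ T⁵
  R≈ n k = refl
  reassociate : x⁴y² T⁵ ≈ 𝑥 *ₛ 𝑥 *ₛ 𝑥 *ₛ 𝑥 *ₛ 𝑦 *ₛ 𝑦 *ₛ T⁵
  reassociate = solve 3 (λ x y t → x :* (x :* (x :* (x :* (y :* (y :* t))))) := x :* x :* x :* x :* y :* y :* t) ≈-refl 𝑥 𝑦 T⁵
    where open import Algebra.Solver.Ring.NaturalCoefficients.Default (CommutativeRing.commutativeSemiring ℤ[[y]][[x]].seriesRing)
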